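{- There exist an absolute constant $C>0$ and a function $\varepsilon:\mathbb{Z}_{\ge 1}\to\mathbb{R}$ with $\varepsilon(k)\to 0$ as $k\to\infty$ such that, for every integer $k\ge 1$ and every integer partition $\lambda=(\lambda_1\ge\lambda_2\ge\cdots)$ with at most $k$ nonzero parts and $\lambda_1\ge 2$, the semiring complexity of the Schur polynomial $s_\lambda(x_1,\dots,x_k)$ is at most $$k^{k^2\left(\frac14+\varepsilon(k)\right)}\cdot C\log(\lambda_1).$$ In particular, for every fixed $k\ge1$ the semiring complexity is $O(\log(\lambda_1))$: there is a constant $C_k$ depending only on $k$ such that the semiring complexity of $s_\lambda(x_1,\dots,x_k)$ is at most $C_k\log(\lambda_1)$ for all such $\lambda$.
   Context: Semiring complexity: for a polynomial $f(x_1,\dots,x_k)$ with nonnegative integer coefficients, the semiring complexity of $f$ is the smallest number of gates in an arithmetic circuit in which each gate performs a (binary) addition or multiplication, whose inputs are $x_1,\dots,x_k$ together with any positive integer scalars, and whose output is $f(x_1,\dots,x_k)$. Subtraction and division are not allowed; gates may have arbitrary fan-out. Schur polynomial: a semistandard Young tableau $T$ of shape $\lambda$ is an array of positive integers $T=(t_{i,j}\mid i\ge 1,\ 1\le j\le\lambda_i)$ with $t_{i,j}<t_{i+1,j}$ and $t_{i,j}\le t_{i,j+1}$ whenever both entries exist. Then $s_\lambda(x_1,\dots,x_k)=\sum_T\prod_{i,j}x_{t_{i,j}}$, the sum over all semistandard Young tableaux $T$ of shape $\lambda$ with entries in $\{1,\dots,k\}$. -}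

module Defs where

open import Data.Nat.Base using (ℕ; zero; suc; _+_; _*_; _^_; _≤_; _≥_; NonZero)
open import Data.Integer.Base using (+_; -[1+_])
open import Data.Rational.Unnormalised.Base as ℚ using (ℚᵘ; mkℚᵘ; 0ℚᵘ)
open import Data.Fin.Base as Fin using (Fin; zero; suc)
import Data.Fin.Properties as Fin
open import Data.List.Base as List
  using (List; []; _∷_; _++_; allFin; cartesianProductWith; concat; filter; foldr; map; replicate; zip)
open import Data.List.Relation.Unary.All as All using (All)
open import Data.List.Relation.Unary.Linked as Linked using (Linked)
open import Data.List.Relation.Binary.Permutation.Propositional using (_↭_)
open import Data.Vec.Base as Vec using (Vec; []; _∷_; toList; _[_]≔_)
import Data.Vec.Relation.Unary.Linked as VecLinked
open import Data.Product.Base using (Σ; _×_; _,_; ∃-syntax; uncurry)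
open import Relation.Nullary.Decidable using (Dec; _×-dec_)

-- Monomials in k variables are exponent vectors.

Monomial : ℕ → Set
Monomial k = Vec ℕ k

1ᵐ : ∀ {k} → Monomial k
1ᵐ = Vec.replicate _ 0

_*ᵐ_ : ∀ {k} → Monomial k → Monomial k → Monomial k
_*ᵐ_ = Vec.zipWith _+_

varᵐ : ∀ {k} → Fin k → Monomial k
varᵐ i = 1ᵐ [ i ]≔ 1

-- A polynomial over ℕ is a finite multiset of monomials, the coefficient of a
-- monomial being its multiplicity: it is represented by a list, and equality of
-- polynomials is the permutation relation _↭_.

Poly : ℕ → Set
Poly k = List (Monomial k)

constᵖ : ∀ {k} → ℕ → Poly k
constᵖ c = replicate c 1ᵐ

varᵖ : ∀ {k} → Fin k → Poly k
varᵖ i = varᵐ i ∷ []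

_+ᵖ_ : ∀ {k} → Poly k → Poly k → Poly k
_+ᵖ_ = _++_

_*ᵖ_ : ∀ {k} → Poly k → Poly k → Poly k
_*ᵖ_ = cartesianProductWith _*ᵐ_

-- A circuit with n gates is a straight-line program.  Every gate may read any
-- earlier gate any number of times, so fan-out is unrestricted; inputs and
-- scalars are not counted as gates.  Index zero is the most recent gate.

data Source (k n : ℕ) : Set where
  var    : Fin k → Source k n
  scalar : (c : ℕ) → .{{NonZero c}} → Source k n
  gate   : Fin n → Source k n

data Gate (k n : ℕ) : Set where
  add mul : Source k n → Source k n → Gate k n

infixl 5 _▷_

data Circuit (k : ℕ) : ℕ → Set where
  []  : Circuit k 0
  _▷_ : ∀ {n} → Circuit k n → Gate k n → Circuit k (suc n)

sourceValue : ∀ {k n} → Vec (Poly k) n → Source k n → Poly k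
sourceValue vs (var i)    = varᵖ i
sourceValue vs (scalar c) = constᵖ c
sourceValue vs (gate g)   = Vec.lookup vs g

gateValue : ∀ {k n} → Vec (Poly k) n → Gate k n → Poly k
gateValue vs (add s t) = sourceValue vs s +ᵖ sourceValue vs t
gateValue vs (mul s t) = sourceValue vs s *ᵖ sourceValue vs t

values : ∀ {k n} → Circuit k n → Vec (Poly k) n
values []      = []
values (c ▷ g) = gateValue (values c) g ∷ values c

-- The output may also be an input or a scalar, which then costs no gate.

ComputableWith : ∀ {k} → Poly k → ℕ → Set
ComputableWith {k} f n =
  Σ (Circuit k n) λ c → Σ (Source k n) λ out → sourceValue (values c) out ↭ f

-- The semiring complexity of f is the least n with ComputableWith f n.  For a
-- bound B, given as the predicate "n is at most B", the complexity is at most B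
-- exactly when some n satisfying the predicate is attained; this does not
-- require constructing the minimum itself.

SemiringComplexityAtMost : ∀ {k} → Poly k → (ℕ → Set) → Set
SemiringComplexityAtMost f _≤B = ∃[ n ] (ComputableWith f n × (n ≤B))

-- Partitions with at most k nonzero parts, padded with zeros to length k.

record Partition (k : ℕ) : Set where
  field
    parts      : Vec ℕ k
    decreasing : VecLinked.Linked _≥_ parts

open Partition public

firstPart : ∀ {k} → Partition k → ℕ
firstPart p with parts p
... | []    = 0
... | l ∷ _ = l

-- A tableau is its list of rows.

Tableau : ℕ → Set
Tableau k = List (List (Fin k))

-- zip truncates to the columns present in both rows.

ColumnStrict : ∀ {k} → List (Fin k) → List (Fin k) → Set
ColumnStrict r s = All (uncurry Fin._<_) (zip r s)

Semistandard : ∀ {k} → Tableau k → Set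
Semistandard T = All (Linked Fin._≤_) T × Linked ColumnStrict T

semistandard? : ∀ {k} (T : Tableau k) → Dec (Semistandard T)
semistandard? T =
  All.all? (Linked.linked? Fin._≤?_) T
    ×-dec Linked.linked? (λ r s → All.all? (λ (a , b) → a Fin.<? b) (zip r s)) T

-- All lists whose i-th entry is taken from the i-th given list.

choices : ∀ {A : Set} → List (List A) → List (List A)
choices = foldr (cartesianProductWith _∷_) ([] ∷ [])

fillings : ∀ {k} → List ℕ → List (Tableau k)
fillings ls = choices (map (λ l → choices (replicate l (allFin _))) ls)

weight : ∀ {k} → Tableau k → Monomial k
weight T = foldr _*ᵐ_ 1ᵐ (map varᵐ (concat T))

schur : ∀ {k} → Partition k → Poly k
schur p = map weight (filter semistandard? (fillings (toList (parts p))))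

-- ε k → 0 as k → ∞.  Rational values suffice for ε: a real-valued one can be
-- replaced by a rational one in [ ε k , ε k + 1 / k ], which only increases the
-- bound k ^ q · C · log₂ m below.  Likewise C may be taken in ℕ.

TendsToZero : (ℕ → ℚᵘ) → Set
TendsToZero ε = ∀ δ → 0ℚᵘ ℚ.< δ → ∃[ N ] (∀ k → N ≤ k → ℚ.∣ ε k ∣ ℚ.< δ)

-- n ≤ (u / v) · log₂ m, for m ≥ 1 and v ≥ 1, with both sides multiplied by v
-- and exponentiated.

AtMostLog : (u v m n : ℕ) → Set
AtMostLog u v m n = 2 ^ (n * v) ≤ m ^ u

-- k ^ q ≤ u / v, for k ≥ 1 and v ≥ 1, with both sides raised to the
-- denominator of q (which is suc d for mkℚᵘ _ d).

PowerAtMost : (k : ℕ) (q : ℚᵘ) (u v : ℕ) → Set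
PowerAtMost k (mkℚᵘ (+ a)    d) u v = k ^ a * v ^ suc d ≤ u ^ suc d
PowerAtMost k (mkℚᵘ -[1+ a ] d) u v = v ^ suc d ≤ u ^ suc d * k ^ suc a

-- n ≤ k ^ q · C · log₂ m.  The real number k ^ q is the infimum of the rationals
-- u / v above it, so the inequality holds iff it holds with each such u / v in
-- place of k ^ q.

AtMostPowerLog : (k : ℕ) (q : ℚᵘ) (C m n : ℕ) → Set
AtMostPowerLog k q C m n =
  ∀ u v → .{{NonZero v}} → PowerAtMost k q u v → AtMostLog (u * C) v m n

{-# OPTIONS --safe #-}

-- Record a tableau by S i t, the number of entries below t in row i.  The
-- tableaux of shape λ become the solutions of a system of difference constraints
-- "y s ≤ y t", and a tableau contributes the product of x_t ^ (S i (t+1) − S i t).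
-- Consider more generally constraints y s + c ≤ y t with c ∈ {0 , 1}, where each
-- solution is weighted by the product of w ^ (y t − y s − c).  Splitting off the low
-- bits, y = 2 y′ + β, turns such a constraint into one of the same shape for y′, with
-- a new c, while the weight becomes w ^ (one bit) times (w²) ^ (y′ t − y′ s − c).
-- So each generating polynomial is a sum, over the bit vectors β, of monomials times
-- generating polynomials with one bit less, at the squared weights.  There are
-- O(k²) unknowns and constraints, hence 2 ^ O(k²) gates suffice per bit of λ₁, and
-- 2 ^ O(k²) = k ^ (k² · O(1 / log k)).

module Submission where

open import Defs
open import Algebra.Bundles using (CommutativeMonoid)
open import Data.Bool.Base using (Bool; true; false; not; _∧_; _∨_; _xor_; T)
open import Data.Fin.Base as Fin using (Fin; zero; suc; toℕ; inject₁; fromℕ; combine; remQuot)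
import Data.Fin.Properties as Fin
import Data.Integer.Base as ℤ
import Data.Integer.Properties as ℤ
open import Data.List.Base as List using (List; []; _∷_; _++_; length; concat; allFin; filter; cartesianProductWith)
import Data.List.Properties as List
open import Data.List.Membership.Propositional using (_∈_)
import Data.List.Membership.Propositional.Properties as ∈
open import Data.List.Membership.Propositional.Properties.WithK using (unique∧set⇒bag)
open import Data.List.Relation.Binary.BagAndSetEquality using (∼bag⇒↭)
open import Data.List.Relation.Binary.Permutation.Propositional as ↭ using (_↭_)
import Data.List.Relation.Binary.Permutation.Propositional.Properties as ↭
open import Data.List.Relation.Unary.All as All using (All; []; _∷_)
import Data.List.Relation.Unary.All.Properties as All
open import Data.List.Relation.Unary.AllPairs as AllPairs using (AllPairs; []; _∷_)
import Data.List.Relation.Unary.AllPairs.Properties as AllPairs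
open import Data.List.Relation.Unary.Any using (here; there)
open import Data.List.Relation.Unary.Any.Properties using (¬Any[])
open import Data.List.Relation.Unary.Linked as Linked using (Linked; []; [-]; _∷_)
import Data.List.Relation.Unary.Linked.Properties as Linked
open import Data.List.Relation.Unary.Unique.Propositional using (Unique)
import Data.List.Relation.Unary.Unique.Propositional.Properties as Unique
open import Data.Nat.Base hiding (_/_)
open import Data.Nat.Properties as ℕ
open import Data.Nat.Tactic.RingSolver using (solve-∀)
open import Data.Product.Base using (_×_; _,_; ∃-syntax; proj₁; proj₂; map₂; uncurry)
open import Data.Rational.Unnormalised.Base as ℚ using (ℚᵘ; mkℚᵘ; _/_)
open import Data.Sum.Base using (_⊎_; inj₁; inj₂; [_,_]′)
open import Data.Vec.Base as Vec using (Vec; []; _∷_; lookup; replicate; zipWith; toList)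
import Data.Vec.Properties as Vec
open import Data.Vec.Relation.Binary.Pointwise.Extensional using (ext; Pointwise-≡⇒≡)
open import Data.Vec.Relation.Binary.Pointwise.Inductive as Pointwise using (Pointwise; []; _∷_)
import Data.Vec.Relation.Unary.Linked.Properties as VecLinked
open import Function.Base using (_∘_; id)
open import Function.Bundles using (mk⇔)
open import Level using (0ℓ)
open import Relation.Binary.Definitions using (tri<; tri≈; tri>)
open import Relation.Binary.PropositionalEquality
open import Relation.Nullary using (Dec; yes; no; does; contradiction; ¬_)

-- Following a single generating polynomial down would branch over all bit vectors at every level
-- and cost a power of λ₁. The cost stays linear in the number of bits because the branches share
-- their targets: the halved pinned values and the squared weights depend neither on the chosen bits
-- nor on the present offsets c. So all branches land in one family of at most 2 ^ m polynomials, m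
-- being the number of constraints, indexed by the vectors of new offsets; each level computes its
-- whole family from the family one bit shorter. The offsets remain in {0, 1} because c is replaced
-- by the ceiling of (α + c - β) / 2, where α and β are bits. The shape enters only through the
-- pinned values. Their bits are known, so they are shed level by level rather than summed over, and
-- the numbers of nodes and constraints depend on k alone.

private variable
  k m n p q : ℕ

-- Circuits

Program : ℕ → Set
Program k = ∃[ n ] Circuit k n

-- Scalars are positive, so no circuit computes the zero polynomial: it counts as
-- always available, and sums simply skip it.

Avail : Program k → Poly k → Set
Avail (_ , c) f = f ≡ [] ⊎ ∃[ s ] (sourceValue (values c) s ↭ f)

infix 4 _≼_

_≼_ : Program k → Program k → Set
C ≼ D = ∀ {f} → Avail C f → Avail D f

record _⇝[_]_ (C : Program k) (m : ℕ) (fs : List (Poly k)) : Set where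
  constructor extension
  field
    result : Program k
    size   : proj₁ result ≤ m + proj₁ C
    keeps  : C ≼ result
    gets   : All (Avail result) fs

weaken : Source k n → Source k (suc n)
weaken (var i)    = var i
weaken (scalar c) = scalar c
weaken (gate g)   = gate (suc g)

weaken-value : ∀ (v : Poly k) (vs : Vec (Poly k) n) s →
               sourceValue (v ∷ vs) (weaken s) ≡ sourceValue vs s
weaken-value v vs (var i)    = refl
weaken-value v vs (scalar c) = refl
weaken-value v vs (gate g)   = refl

free : ∀ {C : Program k} {f} → Avail C f → C ⇝[ 0 ] (f ∷ [])
free a = extension _ ℕ.≤-refl id (a ∷ [])

appendGate : (C : Program k) (g : Gate k (proj₁ C)) {f : Poly k} →
             gateValue (values (proj₂ C)) g ↭ f → C ⇝[ 1 ] (f ∷ [])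
appendGate (n , c) g g↭f = extension (suc n , c ▷ g) ℕ.≤-refl keep (inj₂ (gate zero , g↭f) ∷ [])
  where
  keep : (n , c) ≼ (suc n , c ▷ g)
  keep (inj₁ e)       = inj₁ e
  keep (inj₂ (s , p)) = inj₂ (weaken s , ↭.↭-trans (↭.↭-reflexive (weaken-value _ (values c) s)) p)

relax : ∀ {C : Program k} {m m′ fs} → m ≤ m′ → C ⇝[ m ] fs → C ⇝[ m′ ] fs
relax m≤m′ (extension D s κ γ) = extension D (ℕ.≤-trans s (ℕ.+-monoˡ-≤ _ m≤m′)) κ γ

addGate : ∀ {C : Program k} {f g} → Avail C f → Avail C g → C ⇝[ 1 ] ((f ++ g) ∷ [])
addGate (inj₁ refl) b = relax z≤n (free b)
addGate {C = C} {f} a@(inj₂ _) (inj₁ refl) =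
  relax z≤n (free (subst (Avail C) (sym (List.++-identityʳ f)) a))
addGate {C = C} (inj₂ (s , p)) (inj₂ (t , q)) = appendGate C (add s t) (↭.++⁺ p q)

mulGate : ∀ {C : Program k} {x : Monomial k} {f} → Avail C (x ∷ []) → Avail C f →
          C ⇝[ 1 ] (List.map (x *ᵐ_) f ∷ [])
mulGate (inj₂ _) (inj₁ refl) = relax z≤n (free (inj₁ refl))
mulGate {C = C} {x} {f} (inj₂ (s , p)) (inj₂ (t , q)) = appendGate C (mul s t) product
  where
  product : gateValue (values (proj₂ C)) (mul s t) ↭ List.map (x *ᵐ_) f
  -- A permutation of a one-element list is that list, so the product is a map over the second
  -- factor followed by an empty tail.
  product rewrite ↭.↭-singleton-inv p =
    ↭.↭-trans (↭.↭-reflexive (List.++-identityʳ _)) (↭.map⁺ (x *ᵐ_) q)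

andThen : ∀ {C : Program k} {m m′ fs gs} → C ⇝[ m ] fs →
          (∀ {D} → C ≼ D → All (Avail D) fs → D ⇝[ m′ ] gs) → C ⇝[ m + m′ ] gs
andThen {C = C} {m} {m′} (extension D s κ γ) next with next κ γ
... | extension E s′ κ′ γ′ = extension E bound (κ′ ∘ κ) γ′
  where
  open ℕ.≤-Reasoning
  bound : proj₁ E ≤ m + m′ + proj₁ C
  bound = begin
    proj₁ E            ≤⟨ s′ ⟩
    m′ + proj₁ D       ≤⟨ ℕ.+-monoʳ-≤ m′ s ⟩
    m′ + (m + proj₁ C) ≡⟨ ℕ.+-assoc m′ m _ ⟨
    m′ + m + proj₁ C   ≡⟨ cong (_+ proj₁ C) (ℕ.+-comm m′ m) ⟩
    m + m′ + proj₁ C   ∎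

alongside : ∀ {C : Program k} {m f fs} → Avail C f → C ⇝[ m ] fs → C ⇝[ m ] (f ∷ fs)
alongside a (extension D s κ γ) = extension D s κ (κ a ∷ γ)

-- Quantifying over all later programs lets constructions be run one after another.

Reachable : Program k → ℕ → Poly k → Set
Reachable C q f = ∀ {D} → C ≼ D → D ⇝[ q ] (f ∷ [])

batch : ∀ {C : Program k} fs → (∀ {f} → f ∈ fs → Reachable C q f) → C ⇝[ length fs * q ] fs
batch [] r = extension _ ℕ.≤-refl id []
batch (f ∷ fs) r = andThen (r (here refl) id) λ { κ (a ∷ []) →
  alongside a (batch fs λ f∈ κ′ → r (there f∈) (κ′ ∘ κ)) }

-- The sum is folded from the right, starting at the zero polynomial, which is free. Each summand
-- thus costs its own `q` gates and one addition.
sumGates : ∀ {C : Program k} fs → (∀ {f} → f ∈ fs → Reachable C q f) →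
           Reachable C (length fs * (q + 1)) (concat fs)
sumGates [] r κ = free (inj₁ refl)
sumGates {q = q} {C = C} (f ∷ fs) r {D} κ =
  subst (D ⇝[_] (concat (f ∷ fs) ∷ [])) arith
  (andThen (r (here refl) κ) λ { κ₁ (a ∷ []) →
   andThen (sumGates fs (λ f∈ → r (there f∈)) (κ₁ ∘ κ)) λ { κ₂ (b ∷ []) →
   addGate (κ₂ a) b } })
  where
  arith : q + (length fs * (q + 1) + 1) ≡ q + 1 + length fs * (q + 1)
  arith = begin
    q + (length fs * (q + 1) + 1) ≡⟨ cong (q +_) (ℕ.+-comm (length fs * (q + 1)) 1) ⟩
    q + (1 + length fs * (q + 1)) ≡⟨ ℕ.+-assoc q 1 _ ⟨
    q + 1 + length fs * (q + 1)   ∎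
    where open ≡-Reasoning

-- The commutative monoid of monomials

monomials : ℕ → CommutativeMonoid 0ℓ 0ℓ
monomials k = record
  { Carrier = Monomial k ; _≈_ = _≡_ ; _∙_ = _*ᵐ_ ; ε = 1ᵐ
  ; isCommutativeMonoid = record
    { isMonoid = record
      { isSemigroup = record
        { isMagma = record { isEquivalence = isEquivalence ; ∙-cong = cong₂ _*ᵐ_ }
        ; assoc   = Vec.zipWith-assoc ℕ.+-assoc }
      ; identity = Vec.zipWith-identityˡ ℕ.+-identityˡ , Vec.zipWith-identityʳ ℕ.+-identityʳ }
    ; comm = Vec.zipWith-comm ℕ.+-comm } }

module Mono {k : ℕ} where
  open CommutativeMonoid (monomials k) public using (identityˡ; identityʳ; assoc)
  open import Algebra.Properties.CommutativeMonoid.Mult (monomials k) public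
    using (×-homo-+; ×-distrib-+) renaming (_×_ to times)
  open import Algebra.Properties.CommutativeSemigroup
    (CommutativeMonoid.commutativeSemigroup (monomials k)) public using (interchange)

infixr 25 _^ᵐ_

_^ᵐ_ : Monomial k → ℕ → Monomial k
w ^ᵐ n = Mono.times n w

-- Binary digits

bit : Bool → ℕ
bit false = 0
bit true  = 1

twice+ : Bool → ℕ → ℕ
twice+ b n = bit b + (n + n)

lowBit : ℕ → Bool
lowBit zero          = false
lowBit (suc zero)    = true
lowBit (suc (suc n)) = lowBit n

split-bit : ∀ n → n ≡ twice+ (lowBit n) ⌊ n /2⌋
split-bit zero          = refl
split-bit (suc zero)    = refl
split-bit (suc (suc n)) = trans (cong (2 +_) (split-bit n)) (solve (bit (lowBit n)) ⌊ n /2⌋)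
  where
  solve : ∀ b h → suc (suc (b + (h + h))) ≡ b + (suc h + suc h)
  solve = solve-∀

twice+-injective : ∀ b c {m n} → twice+ b m ≡ twice+ c n → b ≡ c × m ≡ n
twice+-injective b c {m} {n} eq = b≡c , m≡n b≡c eq
  where
  lowBit-twice : ∀ b n → lowBit (twice+ b n) ≡ b
  lowBit-twice false zero    = refl
  lowBit-twice true  zero    = refl
  lowBit-twice b     (suc n) = trans (cong lowBit (shift (bit b) n)) (lowBit-twice b n)
    where
    shift : ∀ b n → b + (suc n + suc n) ≡ suc (suc (b + (n + n)))
    shift = solve-∀
  b≡c : b ≡ c
  b≡c = trans (sym (lowBit-twice b m)) (trans (cong lowBit eq) (lowBit-twice c n))
  m≡n : b ≡ c → twice+ b m ≡ twice+ c n → m ≡ n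
  m≡n refl e = *-cancelˡ-≡ m n 2 (trans (dbl m) (trans (ℕ.+-cancelˡ-≡ (bit b) _ _ e) (sym (dbl n))))
    where
    dbl : ∀ n → 2 * n ≡ n + n
    dbl = solve-∀

bit≤1 : ∀ b → bit b ≤ 1
bit≤1 false = z≤n
bit≤1 true  = s≤s z≤n

-- With α, β the low bits of a, b: the inequality a + c ≤ b becomes
-- ⌊a/2⌋ + carry ≤ ⌊b/2⌋, and rest is the low bit of b − a − c.

carry rest : Bool → Bool → Bool → Bool
carry α β c = (α ∧ c) ∨ ((α ∨ c) ∧ not β)
rest α β c = (α xor β) xor c

-- The defining equation β + 2 · carry = α + c + rest of the two Boolean formulas; all later
-- arithmetic on halving uses only this and rest ≤ 1.
carry-rest : ∀ α β c → bit β + (bit (carry α β c) + bit (carry α β c)) ≡ bit α + bit c + bit (rest α β c)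
carry-rest false false false = refl
carry-rest false false true  = refl
carry-rest false true  false = refl
carry-rest false true  true  = refl
carry-rest true  false false = refl
carry-rest true  false true  = refl
carry-rest true  true  false = refl
carry-rest true  true  true  = refl

-- If `b` were below `a` + carry, doubling would leave the right side short by at least 2 - rest,
-- which is positive.
halve-≤ : ∀ α β c {a b} → twice+ α a + bit c ≤ twice+ β b → a + bit (carry α β c) ≤ b
halve-≤ α β c {a} {b} h = ≮⇒≥ λ b< → <⇒≱ (s≤s (bit≤1 (rest α β c))) (+-cancelˡ-≤ X 2 _ (bound b<))
  where
  X = twice+ α a + bit c
  k′ = bit (carry α β c)
  lemma₁ : ∀ β b → β + (b + b) + 2 ≡ β + (suc b + suc b)
  lemma₁ = solve-∀
  lemma₂ : ∀ β a k → β + (a + k + (a + k)) ≡ β + (k + k) + (a + a)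
  lemma₂ = solve-∀
  lemma₃ : ∀ α c r a → α + c + r + (a + a) ≡ α + (a + a) + c + r
  lemma₃ = solve-∀
  open ≤-Reasoning
  bound : suc b ≤ a + k′ → X + 2 ≤ X + bit (rest α β c)
  bound b< = begin
    X + 2                                          ≤⟨ +-monoˡ-≤ 2 h ⟩
    twice+ β b + 2                                 ≡⟨ lemma₁ (bit β) b ⟩
    bit β + (suc b + suc b)                        ≤⟨ +-monoʳ-≤ (bit β) (+-mono-≤ b< b<) ⟩
    bit β + (a + k′ + (a + k′))                    ≡⟨ lemma₂ (bit β) a k′ ⟩
    bit β + (k′ + k′) + (a + a)                    ≡⟨ cong (_+ (a + a)) (carry-rest α β c) ⟩
    bit α + bit c + bit (rest α β c) + (a + a)     ≡⟨ lemma₃ (bit α) (bit c) (bit (rest α β c)) a ⟩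
    X + bit (rest α β c)                           ∎

-- This single identity gives both the converse of `halve-≤` and the exponents of the weights: the
-- old slack is rest plus twice the new one.
twice+-slack : ∀ α β c {a b} → a + bit (carry α β c) ≤ b →
               twice+ β b ≡ (twice+ α a + bit c) + twice+ (rest α β c) (b ∸ (a + bit (carry α β c)))
twice+-slack α β c {a} {b} h = trans (cong (twice+ β) (sym (m+[n∸m]≡n h))) (lemma (b ∸ (a + bit (carry α β c))))
  where
  lemma₂ : ∀ β a k d → β + (a + k + d + (a + k + d)) ≡ β + (k + k) + (a + a) + (d + d)
  lemma₂ = solve-∀
  lemma₃ : ∀ α c r a d → α + c + r + (a + a) + (d + d) ≡ α + (a + a) + c + (r + (d + d))
  lemma₃ = solve-∀
  lemma : ∀ d → twice+ β (a + bit (carry α β c) + d) ≡ (twice+ α a + bit c) + twice+ (rest α β c) d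
  lemma d = trans (lemma₂ (bit β) a (bit (carry α β c)) d)
              (trans (cong (λ x → x + (a + a) + (d + d)) (carry-rest α β c))
                     (lemma₃ (bit α) (bit c) (bit (rest α β c)) a d))

halve-≤⁻¹ : ∀ α β c {a b} → a + bit (carry α β c) ≤ b → twice+ α a + bit c ≤ twice+ β b
halve-≤⁻¹ α β c h rewrite twice+-slack α β c h = m≤m+n _ _

halve-∸ : ∀ α β c {a b} → a + bit (carry α β c) ≤ b →
          twice+ β b ∸ (twice+ α a + bit c) ≡ twice+ (rest α β c) (b ∸ (a + bit (carry α β c)))
halve-∸ α β c {a} h rewrite twice+-slack α β c h = m+n∸m≡n (twice+ α a + bit c) _

-- Systems of difference constraints

-- A node is one of p pinned values or one of n unknowns.

Node : ℕ → ℕ → Set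
Node p n = Fin p ⊎ Fin n

at : ∀ {A : Set} → Vec A p → Vec A n → Node p n → A
at ps ys = [ lookup ps , lookup ys ]′

Edge : ℕ → ℕ → Set
Edge p n = Node p n × Node p n

Obeys : (Node p n → ℕ) → Edge p n → Bool → Set
Obeys v (s , t) c = v s + bit c ≤ v t

Sat : Vec (Edge p n) m → Vec Bool m → (Node p n → ℕ) → Set
Sat es cs v = Pointwise (Obeys v) es cs

sat? : ∀ (es : Vec (Edge p n) m) cs v → Dec (Sat es cs v)
sat? es cs v = Pointwise.decidable (λ (s , t) c → v s + bit c ≤? v t) es cs

-- The truncated difference is the true slack only where the constraints hold, so the weight is
-- meaningful on solutions only.
slackWeight : Vec (Edge p n) m → Vec Bool m → Vec (Monomial k) m → (Node p n → ℕ) → Monomial k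
slackWeight []             []       []       v = 1ᵐ
slackWeight ((s , t) ∷ es) (c ∷ cs) (w ∷ ws) v =
  w ^ᵐ (v t ∸ (v s + bit c)) *ᵐ slackWeight es cs ws v

carries : Vec (Edge p n) m → Vec Bool m → (Node p n → Bool) → Vec Bool m
carries es cs β = zipWith (λ (s , t) c → carry (β s) (β t) c) es cs

rests : Vec (Edge p n) m → Vec Bool m → Vec (Monomial k) m → (Node p n → Bool) → Monomial k
rests []             []       []       β = 1ᵐ
rests ((s , t) ∷ es) (c ∷ cs) (w ∷ ws) β =
  w ^ᵐ bit (rest (β s) (β t) c) *ᵐ rests es cs ws β

squares : Vec (Monomial k) m → Vec (Monomial k) m
squares = Vec.map (λ w → w *ᵐ w)

module _ {v v′ : Node p n → ℕ} {β : Node p n → Bool} (v≗ : ∀ x → v x ≡ twice+ (β x) (v′ x)) where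

  sat-halve : ∀ (es : Vec (Edge p n) m) cs → Sat es cs v → Sat es (carries es cs β) v′
  sat-halve []             []       []      = []
  sat-halve ((s , t) ∷ es) (c ∷ cs) (h ∷ σ) =
    halve-≤ (β s) (β t) c (subst₂ (λ a b → a + bit c ≤ b) (v≗ s) (v≗ t) h) ∷ sat-halve es cs σ

  sat-twice : ∀ (es : Vec (Edge p n) m) cs → Sat es (carries es cs β) v′ → Sat es cs v
  sat-twice []             []       []      = []
  sat-twice ((s , t) ∷ es) (c ∷ cs) (h ∷ σ) =
    subst₂ (λ a b → a + bit c ≤ b) (sym (v≗ s)) (sym (v≗ t)) (halve-≤⁻¹ (β s) (β t) c h) ∷ sat-twice es cs σ

  slackWeight-halve : ∀ (es : Vec (Edge p n) m) cs (ws : Vec (Monomial k) m) → Sat es (carries es cs β) v′ →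
    slackWeight es cs ws v ≡ rests es cs ws β *ᵐ slackWeight es (carries es cs β) (squares ws) v′
  slackWeight-halve [] [] [] [] = sym (Mono.identityˡ 1ᵐ)
  slackWeight-halve ((s , t) ∷ es) (c ∷ cs) (w ∷ ws) (h ∷ σ) = begin
    w ^ᵐ (v t ∸ (v s + bit c)) *ᵐ slackWeight es cs ws v
      ≡⟨ cong₂ _*ᵐ_ (cong₂ (λ a b → w ^ᵐ (b ∸ (a + bit c))) (v≗ s) (v≗ t)) (slackWeight-halve es cs ws σ) ⟩
    w ^ᵐ (twice+ (β t) (v′ t) ∸ (twice+ (β s) (v′ s) + bit c)) *ᵐ (R *ᵐ S)
      ≡⟨ cong (λ z → w ^ᵐ z *ᵐ (R *ᵐ S)) (halve-∸ (β s) (β t) c h) ⟩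
    w ^ᵐ (r + (d + d)) *ᵐ (R *ᵐ S)
      ≡⟨ cong (_*ᵐ (R *ᵐ S)) (trans (Mono.×-homo-+ w r (d + d)) (cong (w ^ᵐ r *ᵐ_) (trans (Mono.×-homo-+ w d d) (sym (Mono.×-distrib-+ w w d))))) ⟩
    (w ^ᵐ r *ᵐ (w *ᵐ w) ^ᵐ d) *ᵐ (R *ᵐ S)
      ≡⟨ Mono.interchange _ _ _ _ ⟩
    (w ^ᵐ r *ᵐ R) *ᵐ ((w *ᵐ w) ^ᵐ d *ᵐ S) ∎
    where
    open ≡-Reasoning
    r = bit (rest (β s) (β t) c)
    d = v′ t ∸ (v′ s + bit (carry (β s) (β t) c))
    R = rests es cs ws β
    S = slackWeight es (carries es cs β) (squares ws) v′

-- Enumerating vectors by their binary digits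

bitVectors : ∀ n → List (Vec Bool n)
bitVectors zero    = [] ∷ []
bitVectors (suc n) = cartesianProductWith _∷_ (false ∷ true ∷ []) (bitVectors n)

bitVectors-unique : ∀ n → Unique (bitVectors n)
bitVectors-unique zero    = [] ∷ []
bitVectors-unique (suc n) =
  Unique.cartesianProductWith⁺ _∷_ Vec.∷-injective (((λ ()) ∷ []) ∷ [] ∷ []) (bitVectors-unique n)

∈-bitVectors : ∀ (β : Vec Bool n) → β ∈ bitVectors n
∈-bitVectors []      = here refl
∈-bitVectors (b ∷ β) = ∈.∈-cartesianProductWith⁺ _∷_ (∈-bool b) (∈-bitVectors β)
  where
  ∈-bool : ∀ b → b ∈ (false ∷ true ∷ [])
  ∈-bool false = here refl
  ∈-bool true  = there (here refl)

length-bitVectors : ∀ n → length (bitVectors n) ≡ 2 ^ n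
length-bitVectors zero    = refl
length-bitVectors (suc n) = begin
  length (List.map (false ∷_) B ++ (List.map (true ∷_) B ++ []))
    ≡⟨ List.length-++ (List.map (false ∷_) B) ⟩
  length (List.map (false ∷_) B) + length (List.map (true ∷_) B ++ [])
    ≡⟨ cong₂ _+_ (List.length-map _ B) (trans (cong length (List.++-identityʳ (List.map (true ∷_) B))) (List.length-map _ B)) ⟩
  length B + length B
    ≡⟨ cong₂ _+_ (length-bitVectors n) (trans (length-bitVectors n) (sym (ℕ.+-identityʳ _))) ⟩
  2 ^ n + (2 ^ n + 0) ∎
  where
  open ≡-Reasoning
  B = bitVectors n

-- These are the vectors with entries below 2 ^ b. Grouping them by low bits makes the recursion
-- `genPoly-suc` an equality of lists, not merely a permutation.
box : ∀ n → ℕ → List (Vec ℕ n)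
box n zero    = replicate n 0 ∷ []
box n (suc b) = cartesianProductWith (zipWith twice+) (bitVectors n) (box n b)

zipWith-twice+-injective : ∀ {β γ : Vec Bool n} {x y} →
  zipWith twice+ β x ≡ zipWith twice+ γ y → β ≡ γ × x ≡ y
zipWith-twice+-injective {β = []}    {[]}    {[]}    {[]}    eq = refl , refl
zipWith-twice+-injective {β = b ∷ β} {c ∷ γ} {m ∷ x} {n ∷ y} eq with Vec.∷-injective eq
... | e , es with twice+-injective b c {m} {n} e | zipWith-twice+-injective es
... | refl , refl | refl , refl = refl , refl

box-unique : ∀ n b → Unique (box n b)
box-unique n zero    = [] ∷ []
box-unique n (suc b) =
  Unique.cartesianProductWith⁺ (zipWith twice+) zipWith-twice+-injective (bitVectors-unique n) (box-unique n b)

half<2^ : ∀ b m → m < 2 ^ suc b → ⌊ m /2⌋ < 2 ^ b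
half<2^ b m h = ≰⇒> λ le → <⇒≱ h (begin
  2 ^ suc b                          ≡⟨ cong (2 ^ b +_) (ℕ.+-identityʳ (2 ^ b)) ⟩
  2 ^ b + 2 ^ b                      ≤⟨ +-mono-≤ le le ⟩
  ⌊ m /2⌋ + ⌊ m /2⌋                  ≤⟨ m≤n+m _ (bit (lowBit m)) ⟩
  twice+ (lowBit m) ⌊ m /2⌋          ≡⟨ split-bit m ⟨
  m                                  ∎)
  where open ≤-Reasoning

split-bits : ∀ (y : Vec ℕ n) → y ≡ zipWith twice+ (Vec.map lowBit y) (Vec.map ⌊_/2⌋ y)
split-bits []      = refl
split-bits (m ∷ y) = cong₂ _∷_ (split-bit m) (split-bits y)

∈-box : ∀ b {y : Vec ℕ n} → (∀ i → lookup y i < 2 ^ b) → y ∈ box n b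
∈-box zero {y} h = here (zeros y h)
  where
  zeros : ∀ {n} (y : Vec ℕ n) → (∀ i → lookup y i < 1) → y ≡ replicate n 0
  zeros []      h = refl
  zeros (m ∷ y) h = cong₂ _∷_ (n<1⇒n≡0 (h zero)) (zeros y (h ∘ suc))
∈-box {n} (suc b) {y} h = subst (_∈ box n (suc b)) (sym (split-bits y))
  (∈.∈-cartesianProductWith⁺ (zipWith twice+) (∈-bitVectors _)
    (∈-box b λ i → subst (_< 2 ^ b) (sym (Vec.lookup-map i ⌊_/2⌋ y)) (half<2^ b _ (h i))))

solutions : Vec (Edge p n) m → Vec Bool m → ℕ → Vec ℕ p → List (Vec ℕ n)
solutions es cs b ps = filter (λ y → sat? es cs (at ps y)) (box _ b)

genPoly : Vec (Edge p n) m → ℕ → Vec ℕ p → Vec Bool m → Vec (Monomial k) m → Poly k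
genPoly es b ps cs ws = List.map (λ y → slackWeight es cs ws (at ps y)) (solutions es cs b ps)

-- A pinned node contributes its own low bit and an unknown contributes the chosen one, so the sum
-- over bit vectors concerns the unknowns alone.
at-split : ∀ (ps : Vec ℕ p) (β : Vec Bool n) y x →
  at ps (zipWith twice+ β y) x ≡ twice+ (at (Vec.map lowBit ps) β x) (at (Vec.map ⌊_/2⌋ ps) y x)
at-split ps β y (inj₁ i) = trans (split-bit (lookup ps i))
  (sym (cong₂ twice+ (Vec.lookup-map i lowBit ps) (Vec.lookup-map i ⌊_/2⌋ ps)))
at-split ps β y (inj₂ i) = Vec.lookup-zipWith twice+ i β y

filter-map : ∀ {A B : Set} {P : B → Set} (P? : ∀ x → Dec (P x)) (f : A → B) xs →
             filter P? (List.map f xs) ≡ List.map f (filter (λ x → P? (f x)) xs)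
filter-map P? f []       = refl
filter-map P? f (x ∷ xs) with does (P? (f x))
... | true  = cong (f x ∷_) (filter-map P? f xs)
... | false = filter-map P? f xs

module _ (es : Vec (Edge p n) m) (b : ℕ) (ps : Vec ℕ p) (cs : Vec Bool m) (ws : Vec (Monomial k) m) where

  private
    β′ : Vec Bool n → Node p n → Bool
    β′ β = at (Vec.map lowBit ps) β

    ps′ = Vec.map ⌊_/2⌋ ps

  genTerm : Vec Bool n → Poly k
  genTerm β = List.map (rests es cs ws (β′ β) *ᵐ_) (genPoly es b ps′ (carries es cs (β′ β)) (squares ws))

  private
    wt : Vec ℕ n → Monomial k
    wt y = slackWeight es cs ws (at ps y)

    fixedBits : ∀ β → List.map wt (filter (λ y → sat? es cs (at ps y)) (List.map (zipWith twice+ β) (box n b)))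
                      ≡ genTerm β
    fixedBits β = begin
      List.map wt (filter (λ y → sat? es cs (at ps y)) (List.map (zipWith twice+ β) (box n b)))
        ≡⟨ cong (List.map wt) (filter-map (λ y → sat? es cs (at ps y)) (zipWith twice+ β) (box n b)) ⟩
      List.map wt (List.map (zipWith twice+ β) (filter (λ y → sat? es cs (at ps (zipWith twice+ β y))) (box n b)))
        ≡⟨ cong (List.map wt ∘ List.map (zipWith twice+ β))
             (List.filter-≐ (λ y → sat? es cs (at ps (zipWith twice+ β y))) (λ y → sat? es cs′ (at ps′ y))
               ((λ {y} → sat-halve {β = β′ β} (at-split ps β y) es cs) , (λ {y} → sat-twice {β = β′ β} (at-split ps β y) es cs)) (box n b)) ⟩
      List.map wt (List.map (zipWith twice+ β) (solutions es cs′ b ps′))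
        ≡⟨ List.map-∘ (solutions es cs′ b ps′) ⟨
      List.map (wt ∘ zipWith twice+ β) (solutions es cs′ b ps′)
        -- The weight factors only where the constraints hold, hence the congruence over members of
        -- the filtered list.
        ≡⟨ List.map-cong-local (All.tabulate λ {y} y∈ → slackWeight-halve (at-split ps β y) es cs ws
              (proj₂ (∈.∈-filter⁻ (λ y → sat? es cs′ (at ps′ y)) {xs = box n b} y∈))) ⟩
      List.map (λ y → rests es cs ws (β′ β) *ᵐ slackWeight es cs′ (squares ws) (at ps′ y)) (solutions es cs′ b ps′)
        ≡⟨ List.map-∘ (solutions es cs′ b ps′) ⟩
      genTerm β ∎
      where
      open ≡-Reasoning
      cs′ = carries es cs (β′ β)

    allBits : ∀ βs → List.map wt (filter (λ y → sat? es cs (at ps y)) (cartesianProductWith (zipWith twice+) βs (box n b)))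
                     ≡ concat (List.map genTerm βs)
    allBits []       = refl
    allBits (β ∷ βs) = begin
      List.map wt (filter S? (List.map (zipWith twice+ β) (box n b) ++ rst))
        ≡⟨ cong (List.map wt) (List.filter-++ S? (List.map (zipWith twice+ β) (box n b)) rst) ⟩
      List.map wt (filter S? (List.map (zipWith twice+ β) (box n b)) ++ filter S? rst)
        ≡⟨ List.map-++ wt (filter S? (List.map (zipWith twice+ β) (box n b))) (filter S? rst) ⟩
      List.map wt (filter S? (List.map (zipWith twice+ β) (box n b))) ++ List.map wt (filter S? rst)
        ≡⟨ cong₂ _++_ (fixedBits β) (allBits βs) ⟩
      genTerm β ++ concat (List.map genTerm βs) ∎
      where
      open ≡-Reasoning
      S? = λ y → sat? es cs (at ps y)
      rst = cartesianProductWith (zipWith twice+) βs (box n b)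

  genPoly-suc : genPoly es (suc b) ps cs ws ≡ concat (List.map genTerm (bitVectors n))
  genPoly-suc = allBits (bitVectors n)

-- Circuits for the generating polynomials

AvailMonomials : Program k → Vec (Monomial k) m → Set
AvailMonomials C ws = ∀ i → Avail C (lookup ws i ∷ [])

1ᵐ-avail : ∀ {C : Program k} → Avail C (1ᵐ ∷ [])
1ᵐ-avail = inj₂ (scalar 1 , ↭.refl)

-- The exponents are bits, so each constraint either multiplies by its weight, at the price of one
-- gate, or contributes nothing.
restsGates : ∀ (es : Vec (Edge p n) m) cs (ws : Vec (Monomial k) m) β {C : Program k} →
             AvailMonomials C ws → C ⇝[ m ] ((rests es cs ws β ∷ []) ∷ [])
restsGates [] [] [] β a = free 1ᵐ-avail
restsGates {m = suc m} ((s , t) ∷ es) (c ∷ cs) (w ∷ ws) β {C} a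
  with rest (β s) (β t) c
... | false rewrite Mono.identityˡ (rests es cs ws β) =
  relax (n≤1+n m) (restsGates es cs ws β (a ∘ suc))
... | true rewrite Mono.identityʳ w =
  subst (C ⇝[_] ((w *ᵐ rests es cs ws β ∷ []) ∷ [])) (ℕ.+-comm m 1)
    (andThen (restsGates es cs ws β (a ∘ suc)) λ { κ (r ∷ []) → mulGate (κ (a zero)) r })

-- With no bits left every node is 0 and every slack is 0: the polynomial is 1, or zero if some
-- constraint has offset 1. Neither costs a gate.
genPoly-zero : ∀ (es : Vec (Edge p n) m) cs {ps} (ws : Vec (Monomial k) m) →
               (∀ i → lookup ps i < 1) → ∀ {C : Program k} → Avail C (genPoly es 0 ps cs ws)
genPoly-zero {p} {n} es cs {ps} ws ps<1 with does (sat? es cs (at ps (replicate n 0)))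
... | false = inj₁ refl
... | true  = subst (λ x → Avail _ (x ∷ [])) (sym (slack-zero es cs ws)) 1ᵐ-avail
  where
  v≗0 : ∀ x → at ps (replicate n 0) x ≡ 0
  v≗0 (inj₁ i) = n<1⇒n≡0 (ps<1 i)
  v≗0 (inj₂ i) = Vec.lookup-replicate i 0
  slack-zero : ∀ {m} (es : Vec (Edge p n) m) cs ws → slackWeight es cs ws (at ps (replicate n 0)) ≡ 1ᵐ
  slack-zero [] [] [] = refl
  slack-zero ((s , t) ∷ es) (c ∷ cs) (w ∷ ws) = begin
    w ^ᵐ (v t ∸ (v s + bit c)) *ᵐ slackWeight es cs ws v
      ≡⟨ cong₂ (λ a b → w ^ᵐ (a ∸ (v s + bit c)) *ᵐ b) (v≗0 t) (slack-zero es cs ws) ⟩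
    w ^ᵐ (0 ∸ (v s + bit c)) *ᵐ 1ᵐ
      ≡⟨ Mono.identityʳ _ ⟩
    w ^ᵐ (0 ∸ (v s + bit c))
      ≡⟨ cong (w ^ᵐ_) (0∸n≡0 (v s + bit c)) ⟩
    1ᵐ ∎
    where
    open ≡-Reasoning
    v = at ps (replicate n 0)

-- One level takes m squarings of weights and then, for each of the 2 ^ m offset vectors, a sum of 2
-- ^ n terms. A term needs m gates for its monomial, one for the product and one for the addition.
levelCost : ℕ → ℕ → ℕ
levelCost m n = m * 1 + 2 ^ m * (2 ^ n * (m + 1 + 1))

-- The induction runs on the family over all offset vectors, because halving one member can call for
-- any carries.
genPolys : Vec (Edge p n) m → ℕ → Vec ℕ p → Vec (Monomial k) m → List (Poly k)
genPolys {m = m} es b ps ws = List.map (λ cs → genPoly es b ps cs ws) (bitVectors m)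

squaresGates : ∀ (ws : Vec (Monomial k) m) {C : Program k} → AvailMonomials C ws →
  C ⇝[ m * 1 ] List.map (λ i → lookup (squares ws) i ∷ []) (allFin m)
squaresGates {k} {m} ws {C} a = subst (λ l → C ⇝[ l * 1 ] sqs) len (batch sqs gate₁)
  where
  sqs = List.map (λ i → lookup (squares ws) i ∷ []) (allFin m)
  len : length sqs ≡ m
  len = trans (List.length-map _ (allFin m)) (List.length-tabulate id)
  gate₁ : ∀ {f} → f ∈ sqs → Reachable C 1 f
  gate₁ f∈ κ with ∈.∈-map⁻ (λ i → lookup (squares ws) i ∷ []) f∈
  ... | i , _ , refl rewrite Vec.lookup-map i (λ w → w *ᵐ w) ws = mulGate (κ (a i)) (κ (a i))

genPolysGates : ∀ (es : Vec (Edge p n) m) b ps (ws : Vec (Monomial k) m) {C : Program k} →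
  (∀ i → lookup ps i < 2 ^ b) → AvailMonomials C ws → C ⇝[ b * levelCost m n ] genPolys es b ps ws
genPolysGates {m = m} es zero ps ws ps< a =
  extension _ ℕ.≤-refl id (All.map⁺ (All.universal (λ cs → genPoly-zero es cs {ps} ws ps<) (bitVectors m)))
genPolysGates {n = n} {m = m} {k = k} es (suc b) ps ws {C} ps< a =
  subst (C ⇝[_] genPolys es (suc b) ps ws) arith
  (andThen (squaresGates ws a) λ {D} κ a² →
   andThen (genPolysGates es b ps′ (squares ws) {D} ps′< (λ i → All.lookup a² (∈.∈-map⁺ _ (∈.∈-allFin i)))) λ {E} κ′ gs →
   subst (λ l → E ⇝[ l * (2 ^ n * (m + 1 + 1)) ] genPolys es (suc b) ps ws)
     (trans (List.length-map _ (bitVectors m)) (length-bitVectors m))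
     (batch (genPolys es (suc b) ps ws) (one (κ′ ∘ κ) gs)))
  where
  ps′ = Vec.map ⌊_/2⌋ ps
  ps′< : ∀ i → lookup ps′ i < 2 ^ b
  ps′< i = subst (_< 2 ^ b) (sym (Vec.lookup-map i ⌊_/2⌋ ps)) (half<2^ b _ (ps< i))
  one : ∀ {E f} → C ≼ E → All (Avail E) (genPolys es b ps′ (squares ws)) → f ∈ genPolys es (suc b) ps ws → Reachable E (2 ^ n * (m + 1 + 1)) f
  one {E} κ gs f∈ κ₁ with ∈.∈-map⁻ (λ cs → genPoly es (suc b) ps cs ws) f∈
  ... | cs , _ , refl rewrite genPoly-suc es b ps cs ws =
    subst (λ l → _ ⇝[ l * (m + 1 + 1) ] (concat terms ∷ []))
      (trans (List.length-map _ (bitVectors n)) (length-bitVectors n))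
      (sumGates terms term κ₁)
    where
    terms = List.map (genTerm es b ps cs ws) (bitVectors n)
    term : ∀ {f} → f ∈ terms → Reachable E (m + 1) f
    term f∈ κ₂ with ∈.∈-map⁻ (genTerm es b ps cs ws) f∈
    ... | β , _ , refl = andThen (restsGates es cs ws (at (Vec.map lowBit ps) β) (κ₂ ∘ κ ∘ a)) λ { κ₃ (r ∷ []) →
      -- Whatever the carries are, they form a bit vector, so the second factor is already available
      -- from the lower family.
      mulGate r (κ₃ (κ₂ (All.lookup gs (∈.∈-map⁺ _ (∈-bitVectors _))))) }
  arith : m * 1 + (b * levelCost m n + 2 ^ m * (2 ^ n * (m + 1 + 1))) ≡ levelCost m n + b * levelCost m n
  arith = begin
    m * 1 + (b * levelCost m n + X) ≡⟨ cong (m * 1 +_) (ℕ.+-comm (b * levelCost m n) X) ⟩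
    m * 1 + (X + b * levelCost m n) ≡⟨ ℕ.+-assoc (m * 1) X _ ⟨
    levelCost m n + b * levelCost m n ∎
    where
    open ≡-Reasoning
    X = 2 ^ m * (2 ^ n * (m + 1 + 1))

-- Tableaux

prod : List (Monomial k) → Monomial k
prod = List.foldr _*ᵐ_ 1ᵐ

prod-++ : ∀ (xs ys : List (Monomial k)) → prod (xs ++ ys) ≡ prod xs *ᵐ prod ys
prod-++ []       ys = sym (Mono.identityˡ _)
prod-++ (x ∷ xs) ys = trans (cong (x *ᵐ_) (prod-++ xs ys)) (sym (Mono.assoc x _ _))

prod-concat : ∀ (xss : List (List (Monomial k))) → prod (concat xss) ≡ prod (List.map prod xss)
prod-concat []         = refl
prod-concat (xs ∷ xss) = trans (prod-++ xs (concat xss)) (cong (prod xs *ᵐ_) (prod-concat xss))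

prod-ones : ∀ {xs : List (Monomial k)} → All (_≡ 1ᵐ) xs → prod xs ≡ 1ᵐ
prod-ones []          = refl
prod-ones (refl ∷ xs) = trans (Mono.identityˡ _) (prod-ones xs)

prod-tabulate-*ᵐ : ∀ (f g : Fin n → Monomial k) →
  prod (List.tabulate λ i → f i *ᵐ g i) ≡ prod (List.tabulate f) *ᵐ prod (List.tabulate g)
prod-tabulate-*ᵐ {zero}  f g = sym (Mono.identityˡ _)
prod-tabulate-*ᵐ {suc n} f g =
  trans (cong ((f zero *ᵐ g zero) *ᵐ_) (prod-tabulate-*ᵐ (f ∘ suc) (g ∘ suc))) (Mono.interchange _ _ _ _)

prod-tabulate-single : ∀ (f : Fin n → Monomial k) i → (∀ j → i ≢ j → f j ≡ 1ᵐ) →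
  prod (List.tabulate f) ≡ f i
prod-tabulate-single f zero    h =
  trans (cong (f zero *ᵐ_) (prod-ones (All.tabulate⁺ λ j → h (suc j) λ ()))) (Mono.identityʳ _)
prod-tabulate-single f (suc i) h =
  trans (cong₂ _*ᵐ_ (h zero λ ()) (prod-tabulate-single (f ∘ suc) i λ j i≢j → h (suc j) (i≢j ∘ Fin.suc-injective)))
        (Mono.identityˡ _)

-- Rows and their counting functions

below : ℕ → List (Fin k) → ℕ
below t []      = 0
below t (a ∷ r) = bit (toℕ a <ᵇ t) + below t r

<⇒<ᵇ≡true : ∀ {m n} → m < n → (m <ᵇ n) ≡ true
<⇒<ᵇ≡true {m} {n} h with m <ᵇ n | <⇒<ᵇ h
... | true | _ = refl

≥⇒<ᵇ≡false : ∀ {m n} → m ≥ n → (m <ᵇ n) ≡ false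
≥⇒<ᵇ≡false {m} {n} h with m <ᵇ n in eq
... | false = refl
... | true  = contradiction h (<⇒≱ (<ᵇ⇒< m n (subst T (sym eq) _)))

below-yes : ∀ {t} {a : Fin k} r → toℕ a < t → below t (a ∷ r) ≡ suc (below t r)
below-yes r h rewrite <⇒<ᵇ≡true h = refl

below-no : ∀ {t} {a : Fin k} r → toℕ a ≥ t → below t (a ∷ r) ≡ below t r
below-no r h rewrite ≥⇒<ᵇ≡false h = refl

below-≥ : ∀ {t} {r : List (Fin k)} → All (λ a → toℕ a ≥ t) r → below t r ≡ 0
below-≥ []               = refl
below-≥ {r = _ ∷ r} (h ∷ hs) = trans (below-no r h) (below-≥ hs)

below-zero : ∀ (r : List (Fin k)) → below 0 r ≡ 0
below-zero r = below-≥ (All.universal (λ _ → z≤n) r)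

below-all : ∀ (r : List (Fin k)) → below k r ≡ length r
below-all []      = refl
below-all (a ∷ r) = trans (below-yes r (Fin.toℕ<n a)) (cong suc (below-all r))

below-≤-length : ∀ t (r : List (Fin k)) → below t r ≤ length r
below-≤-length t []      = z≤n
below-≤-length t (a ∷ r) = +-mono-≤ (bit≤1 (toℕ a <ᵇ t)) (below-≤-length t r)

<ᵇ-mono : ∀ a {s t} → s ≤ t → bit (a <ᵇ s) ≤ bit (a <ᵇ t)
<ᵇ-mono a {s} {t} s≤t with a <? s
... | yes a<s rewrite <⇒<ᵇ≡true (<-≤-trans a<s s≤t) = bit≤1 (a <ᵇ s)
... | no  a≮s rewrite ≥⇒<ᵇ≡false (≮⇒≥ a≮s) = z≤n

below-mono : ∀ (r : List (Fin k)) {s t} → s ≤ t → below s r ≤ below t r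
below-mono []      s≤t = z≤n
below-mono (a ∷ r) s≤t = +-mono-≤ (<ᵇ-mono (toℕ a) s≤t) (below-mono r s≤t)

∸-+ : ∀ {a b c d} → a ≤ b → c ≤ d → (b + d) ∸ (a + c) ≡ (b ∸ a) + (d ∸ c)
∸-+ {a} {b} {c} {d} a≤b c≤d = begin
  (b + d) ∸ (a + c)   ≡⟨ ∸-+-assoc (b + d) a c ⟨
  b + d ∸ a ∸ c       ≡⟨ cong (_∸ c) (+-∸-comm d a≤b) ⟩
  (b ∸ a) + d ∸ c     ≡⟨ +-∸-assoc (b ∸ a) c≤d ⟩
  (b ∸ a) + (d ∸ c)   ∎
  where open ≡-Reasoning

below-suc-∷ : ∀ t (a : Fin k) r → below (suc t) (a ∷ r) ∸ below t (a ∷ r) ≡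
              (bit (toℕ a <ᵇ suc t) ∸ bit (toℕ a <ᵇ t)) + (below (suc t) r ∸ below t r)
below-suc-∷ t a r = ∸-+ (<ᵇ-mono (toℕ a) (n≤1+n t)) (below-mono r (n≤1+n t))

-- Prepending `a` raises just the exponent at t = a by one, since [a < t + 1] - [a < t] is 1 there
-- and 0 elsewhere.
rowWeight : ∀ (r : List (Fin k)) →
  prod (List.map varᵐ r) ≡ prod (List.tabulate λ t → varᵐ t ^ᵐ (below (suc (toℕ t)) r ∸ below (toℕ t) r))
rowWeight {k} []  = sym (prod-ones (All.tabulate⁺ {n = k} {f = λ t → varᵐ t ^ᵐ 0} λ t → refl))
rowWeight {k} (a ∷ r) = begin
  varᵐ a *ᵐ prod (List.map varᵐ r)
    ≡⟨ cong₂ _*ᵐ_ (sym single) (rowWeight r) ⟩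
  prod (List.tabulate e) *ᵐ prod (List.tabulate f)
    ≡⟨ prod-tabulate-*ᵐ e f ⟨
  prod (List.tabulate λ t → e t *ᵐ f t)
    ≡⟨ cong prod (List.tabulate-cong λ t → trans (sym (Mono.×-homo-+ (varᵐ t) (δ t) _)) (cong (varᵐ t ^ᵐ_) (sym (below-suc-∷ (toℕ t) a r)))) ⟩
  prod (List.tabulate λ t → varᵐ t ^ᵐ (below (suc (toℕ t)) (a ∷ r) ∸ below (toℕ t) (a ∷ r))) ∎
  where
  open ≡-Reasoning
  δ : Fin k → ℕ
  δ t = bit (toℕ a <ᵇ suc (toℕ t)) ∸ bit (toℕ a <ᵇ toℕ t)
  e f : Fin k → Monomial k
  e t = varᵐ t ^ᵐ δ t
  f t = varᵐ t ^ᵐ (below (suc (toℕ t)) r ∸ below (toℕ t) r)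
  single : prod (List.tabulate e) ≡ varᵐ a
  single = trans (prod-tabulate-single e a off) on
    where
    on : e a ≡ varᵐ a
    on rewrite <⇒<ᵇ≡true (≤-refl {suc (toℕ a)}) | ≥⇒<ᵇ≡false (≤-refl {toℕ a}) = Mono.identityʳ _
    off : ∀ t → a ≢ t → e t ≡ 1ᵐ
    off t a≢t with <-cmp (toℕ a) (toℕ t)
    ... | tri< a<t _ _ rewrite <⇒<ᵇ≡true a<t | <⇒<ᵇ≡true (m<n⇒m<1+n a<t) = refl
    ... | tri≈ _ a≡t _ = contradiction (Fin.toℕ-injective a≡t) a≢t
    ... | tri> _ _ a>t rewrite ≥⇒<ᵇ≡false a>t | ≥⇒<ᵇ≡false (<⇒≤ a>t) = refl

-- Comparing an entry with all later ones, not only with the next, is what makes the counts below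
-- the head vanish.
Increasing : List (Fin k) → Set
Increasing = AllPairs Fin._≤_

increasing-≥ : ∀ {a : Fin k} {r} → Increasing (a ∷ r) → ∀ {t} → t ≤ toℕ a → All (λ b → toℕ b ≥ t) (a ∷ r)
increasing-≥ (a≤ ∷ _) t≤a = t≤a ∷ All.map (≤-trans t≤a) a≤

below-head : ∀ (a : Fin k) r → below (suc (toℕ a)) (a ∷ r) ≡ suc (below (suc (toℕ a)) r)
below-head a r = below-yes r ≤-refl

-- If the heads differ, the smaller one is counted in its own row at a threshold where the other row
-- still counts nothing. Equal heads cancel from all counts.
increasing-determined : ∀ {r s : List (Fin k)} → Increasing r → Increasing s →
  (∀ (a : Fin k) → below (suc (toℕ a)) r ≡ below (suc (toℕ a)) s) → r ≡ s
increasing-determined {r = []}    {[]}    _ _ h = refl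
increasing-determined {r = []}    {b ∷ s} _ _ h with () ← trans (h b) (below-head b s)
increasing-determined {r = a ∷ r} {[]}    _ _ h with () ← trans (sym (h a)) (below-head a r)
increasing-determined {r = a ∷ r} {b ∷ s} ir@(_ ∷ ir′) is@(_ ∷ is′) h with <-cmp (toℕ a) (toℕ b)
... | tri< a<b _ _ with () ← trans (sym (below-head a r)) (trans (h a) (below-≥ (increasing-≥ is a<b)))
... | tri> _ _ b<a with () ← trans (sym (below-head b s)) (trans (sym (h b)) (below-≥ (increasing-≥ ir b<a)))
... | tri≈ _ a≡b _ with refl ← Fin.toℕ-injective a≡b =
  cong (a ∷_) (increasing-determined ir′ is′ λ c → +-cancelˡ-≡ (bit (toℕ a <ᵇ suc (toℕ c))) _ _ (h c))

-- An entry of `s` that is at most t lies under an entry of `r` that is below t; the comparison of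
-- lengths guarantees that there is an entry above.
columnStrict⇒below : ∀ (r s : List (Fin k)) → ColumnStrict r s → length s ≤ length r →
  ∀ t → below (suc t) s ≤ below t r
columnStrict⇒below r       []      _         _         t = z≤n
columnStrict⇒below (a ∷ r) (b ∷ s) (a<b ∷ h) (s≤s len) t =
  +-mono-≤ here≤ (columnStrict⇒below r s h len t)
  where
  here≤ : bit (toℕ b <ᵇ suc t) ≤ bit (toℕ a <ᵇ t)
  here≤ with toℕ b <? suc t
  ... | yes b≤t rewrite <⇒<ᵇ≡true (<-≤-trans a<b (s≤s⁻¹ b≤t)) = bit≤1 (toℕ b <ᵇ suc t)
  ... | no  b>t rewrite ≥⇒<ᵇ≡false (≮⇒≥ b>t) = z≤n

-- At t = b, the head of the lower row, the hypothesis forces some entry of the upper row below b,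
-- hence its head. Dropping both heads lowers both counts by one when b ≤ t, and for t < b the lower
-- count is 0.
below⇒columnStrict : ∀ {r s : List (Fin k)} → Increasing r → Increasing s →
  (∀ (t : Fin k) → below (suc (toℕ t)) s ≤ below (toℕ t) r) → ColumnStrict r s
below⇒columnStrict {r = []}    {s}     _ _ h = []
below⇒columnStrict {r = a ∷ r} {[]}    _ _ h = []
below⇒columnStrict {k} {r = a ∷ r} {b ∷ s} ir@(_ ∷ ir′) is@(b≤ ∷ is′) h = a<b ∷ below⇒columnStrict ir′ is′ tails
  where
  a<b : toℕ a < toℕ b
  a<b = ≰⇒> λ b≤a → <⇒≱ z<s (subst₂ _≤_ (below-head b s) (below-≥ (increasing-≥ ir b≤a)) (h b))
  tails : ∀ (t : Fin k) → below (suc (toℕ t)) s ≤ below (toℕ t) r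
  tails t with toℕ b ≤? toℕ t
  ... | yes b≤t = s≤s⁻¹ (subst₂ _≤_ (below-yes s (s≤s b≤t)) (below-yes r (<-≤-trans a<b b≤t)) (h t))
  ... | no  b>t = subst (_≤ below (toℕ t) r) (sym (below-≥ (All.map (≤-trans (≰⇒> b>t)) b≤))) z≤n

rowOf : (Fin (suc k) → ℕ) → List (Fin k)
rowOf {zero}  f = []
rowOf {suc k} f = List.replicate (f (suc zero) ∸ f zero) zero ++ List.map suc (rowOf (f ∘ suc))

rowOf-increasing : ∀ (f : Fin (suc k) → ℕ) → Increasing (rowOf f)
rowOf-increasing {zero}  f = []
rowOf-increasing {suc k} f = AllPairs.++⁺ (zeros (f (suc zero) ∸ f zero))
  (AllPairs.map⁺ (AllPairs.map s≤s (rowOf-increasing (f ∘ suc))))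
  (All.replicate⁺ _ (All.universal (λ _ → z≤n) _))
  where
  zeros : ∀ n → Increasing (List.replicate n (zero {k}))
  zeros zero    = []
  zeros (suc n) = All.replicate⁺ n z≤n ∷ zeros n

below-++ : ∀ t (r s : List (Fin k)) → below t (r ++ s) ≡ below t r + below t s
below-++ t []      s = refl
below-++ t (a ∷ r) s = trans (cong (bit (toℕ a <ᵇ t) +_) (below-++ t r s)) (sym (ℕ.+-assoc (bit (toℕ a <ᵇ t)) _ _))

below-map-suc : ∀ t (r : List (Fin k)) → below (suc t) (List.map suc r) ≡ below t r
below-map-suc t []      = refl
below-map-suc t (a ∷ r) = cong (bit (toℕ a <ᵇ t) +_) (below-map-suc t r)

below-replicate-zero : ∀ t n → below (suc t) (List.replicate n (zero {k})) ≡ n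
below-replicate-zero t zero    = refl
below-replicate-zero t (suc n) = cong suc (below-replicate-zero t n)

-- The multiplicities f (t + 1) - f t telescope. The term `f zero` has to stay, because the
-- recursion passes to `f ∘ suc`, whose first value need not be 0.
below-rowOf : ∀ (f : Fin (suc k) → ℕ) → (∀ t → f (inject₁ t) ≤ f (suc t)) →
              ∀ t → below (toℕ t) (rowOf f) ≡ f t ∸ f zero
below-rowOf         f mono zero    = trans (below-zero (rowOf f)) (sym (n∸n≡0 (f zero)))
below-rowOf {suc k} f mono (suc t) = begin
  below (suc (toℕ t)) (List.replicate d zero ++ List.map suc (rowOf (f ∘ suc)))
    ≡⟨ below-++ (suc (toℕ t)) (List.replicate d zero) _ ⟩
  below (suc (toℕ t)) (List.replicate d zero) + below (suc (toℕ t)) (List.map suc (rowOf (f ∘ suc)))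
    ≡⟨ cong₂ _+_ (below-replicate-zero (toℕ t) d) (below-map-suc (toℕ t) (rowOf (f ∘ suc))) ⟩
  d + below (toℕ t) (rowOf (f ∘ suc))
    ≡⟨ cong (d +_) (below-rowOf (f ∘ suc) (mono ∘ suc) t) ⟩
  d + (f (suc t) ∸ f (suc zero))
    ≡⟨ ℕ.+-comm d _ ⟩
  (f (suc t) ∸ f (suc zero)) + (f (suc zero) ∸ f zero)
    ≡⟨ +-∸-assoc (f (suc t) ∸ f (suc zero)) (mono zero) ⟨
  (f (suc t) ∸ f (suc zero)) + f (suc zero) ∸ f zero
    ≡⟨ cong (_∸ f zero) (m∸n+n≡m (first≤ (f ∘ suc) (mono ∘ suc) t)) ⟩
  f (suc t) ∸ f zero ∎
  where
  open ≡-Reasoning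
  d = f (suc zero) ∸ f zero
  first≤ : ∀ {k} (f : Fin (suc k) → ℕ) → (∀ t → f (inject₁ t) ≤ f (suc t)) → ∀ t → f zero ≤ f t
  first≤         f mono zero    = ≤-refl
  first≤ {suc k} f mono (suc t) = ≤-trans (mono zero) (first≤ (f ∘ suc) (mono ∘ suc) t)

-- Rows beyond the last one are read as empty.

row : List (List (Fin k)) → ℕ → List (Fin k)
row []      i       = []
row (r ∷ T) zero    = r
row (r ∷ T) (suc i) = row T i

row-tabulate : ∀ (f : Fin n → List (Fin k)) i → row (List.tabulate f) (toℕ i) ≡ f i
row-tabulate f zero    = refl
row-tabulate f (suc i) = row-tabulate (f ∘ suc) i

tabulate-row : ∀ (T : List (List (Fin k))) → length T ≡ n → List.tabulate {n = n} (row T ∘ toℕ) ≡ T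
tabulate-row []      refl = refl
tabulate-row (r ∷ T) refl = cong (r ∷_) (tabulate-row T refl)

linked-row : ∀ {R : List (Fin k) → List (Fin k) → Set} {T} → Linked R T →
             ∀ {i} → suc i < length T → R (row T i) (row T (suc i))
linked-row [-]      {i}     (s≤s ())
linked-row (h ∷ hs) {zero}  i<  = h
linked-row (h ∷ hs) {suc i} (s≤s i<) = linked-row hs i<

linked-tabulate : ∀ {A : Set} {R : A → A → Set} (f : Fin (suc n) → A) →
                  (∀ i → R (f (inject₁ i)) (f (suc i))) → Linked R (List.tabulate f)
linked-tabulate {zero}  f h = [-]
linked-tabulate {suc n} f h = h zero ∷ linked-tabulate (f ∘ suc) (h ∘ suc)

all-row : ∀ {P : List (Fin k) → Set} {T} → All P T → ∀ {i} → i < length T → P (row T i)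
all-row (h ∷ hs) {zero}  i<       = h
all-row (h ∷ hs) {suc i} (s≤s i<) = all-row hs i<

-- Fillings, enumerated without repetition

choices-unique : ∀ {A : Set} {xss : List (List A)} → All Unique xss → Unique (choices xss)
choices-unique []       = AllPairs._∷_ [] AllPairs.[]
choices-unique (u ∷ us) = Unique.cartesianProductWith⁺ _∷_ List.∷-injective u (choices-unique us)

fillings-unique : ∀ ls → Unique (fillings {k} ls)
fillings-unique {k} ls = choices-unique (All.map⁺ (All.universal
  (λ l → choices-unique (All.replicate⁺ l (Unique.allFin⁺ k))) ls))

∈-rows⁺ : ∀ (r : List (Fin k)) → r ∈ choices (List.replicate (length r) (allFin k))
∈-rows⁺ []      = here refl
∈-rows⁺ (a ∷ r) = ∈.∈-cartesianProductWith⁺ _∷_ (∈.∈-allFin a) (∈-rows⁺ r)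

∈-rows⁻ : ∀ l {r : List (Fin k)} → r ∈ choices (List.replicate l (allFin k)) → length r ≡ l
∈-rows⁻ zero    (here refl) = refl
∈-rows⁻ {k} (suc l) r∈ with ∈.∈-cartesianProductWith⁻ _∷_ (allFin k) _ r∈
... | a , r , _ , r∈ , refl = cong suc (∈-rows⁻ l r∈)

∈-fillings⁺ : ∀ (ls : Vec ℕ n) (f : Fin n → List (Fin k)) → (∀ i → length (f i) ≡ lookup ls i) →
              List.tabulate f ∈ fillings (toList ls)
∈-fillings⁺ []       f h = here refl
∈-fillings⁺ {k = k} (l ∷ ls) f h = ∈.∈-cartesianProductWith⁺ _∷_
  (subst (λ l → f zero ∈ choices (List.replicate l (allFin k))) (h zero) (∈-rows⁺ (f zero)))
  (∈-fillings⁺ ls (f ∘ suc) (h ∘ suc))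

∈-fillings⁻ : ∀ (ls : Vec ℕ n) {T : Tableau k} → T ∈ fillings (toList ls) →
              length T ≡ n × (∀ i → length (row T (toℕ i)) ≡ lookup ls i)
∈-fillings⁻ []       (here refl) = refl , λ ()
∈-fillings⁻ {k = k} (l ∷ ls) T∈ with ∈.∈-cartesianProductWith⁻ _∷_ (choices (List.replicate l (allFin k))) _ T∈
... | r , T , r∈ , T∈ , refl with ∈-fillings⁻ ls T∈
... | len , lens = cong suc len , λ { zero → ∈-rows⁻ l r∈ ; (suc i) → lens i }

-- The constraint system of a shape

module _ (L : List (Edge p n × Monomial k)) where
  edgesOf : Vec (Edge p n) (length L)
  edgesOf = Vec.map proj₁ (Vec.fromList L)

  weightsOf : Vec (Monomial k) (length L)
  weightsOf = Vec.map proj₂ (Vec.fromList L)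

-- A shape starts with all offsets 0: strictness down the columns is expressed by shifting the
-- threshold, so offsets 1 arise only as carries.
unstrict : ∀ m → Vec Bool m
unstrict m = replicate m false

sat⇒all : ∀ (L : List (Edge p n × Monomial k)) {v} → Sat (edgesOf L) (unstrict _) v →
          All (λ ((s , t) , w) → v s ≤ v t) L
sat⇒all []                   []      = []
sat⇒all (((s , t) , w) ∷ L) {v} (h ∷ σ) = subst (_≤ v t) (ℕ.+-identityʳ (v s)) h ∷ sat⇒all L σ

all⇒sat : ∀ (L : List (Edge p n × Monomial k)) {v} → All (λ ((s , t) , w) → v s ≤ v t) L →
          Sat (edgesOf L) (unstrict _) v
all⇒sat []                   []      = []
all⇒sat (((s , t) , w) ∷ L) {v} (h ∷ σ) = subst (_≤ v t) (sym (ℕ.+-identityʳ (v s))) h ∷ all⇒sat L σ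

slackOf : (Node p n → ℕ) → Edge p n × Monomial k → Monomial k
slackOf v ((s , t) , w) = w ^ᵐ (v t ∸ v s)

slackWeight-prod : ∀ (L : List (Edge p n × Monomial k)) v →
  slackWeight (edgesOf L) (unstrict _) (weightsOf L) v ≡ prod (List.map (slackOf v) L)
slackWeight-prod []                  v = refl
slackWeight-prod (((s , t) , w) ∷ L) v =
  cong₂ (λ a b → w ^ᵐ (v t ∸ a) *ᵐ b) (ℕ.+-identityʳ (v s)) (slackWeight-prod L v)

1ᵐ^ : ∀ n → 1ᵐ {k} ^ᵐ n ≡ 1ᵐ
1ᵐ^ zero    = refl
1ᵐ^ (suc n) = trans (Mono.identityˡ _) (1ᵐ^ n)

grid : ∀ {A : Set} → (Fin m → Fin n → A) → List A
grid f = concat (List.tabulate λ i → List.tabulate (f i))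

length-grid : ∀ {A : Set} (f : Fin m → Fin n → A) → length (grid f) ≡ m * n
length-grid {zero}  f = refl
length-grid {suc m} f = trans (List.length-++ (List.tabulate (f zero)))
  (cong₂ _+_ (List.length-tabulate (f zero)) (length-grid (f ∘ suc)))

all-grid⁺ : ∀ {A : Set} {P : A → Set} (f : Fin m → Fin n → A) → (∀ i j → P (f i j)) → All P (grid f)
all-grid⁺ f h = All.concat⁺ (All.tabulate⁺ λ i → All.tabulate⁺ (h i))

all-grid⁻ : ∀ {A : Set} {P : A → Set} (f : Fin m → Fin n → A) → All P (grid f) → ∀ i j → P (f i j)
all-grid⁻ f hs i = All.tabulate⁻ {f = f i} (All.tabulate⁻ {f = λ i → List.tabulate (f i)} (All.concat⁻ hs) i)

prod-grid : ∀ {A : Set} (w : A → Monomial k) (f : Fin m → Fin n → A) →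
  prod (List.map w (grid f)) ≡ prod (List.tabulate λ i → prod (List.tabulate λ j → w (f i j)))
prod-grid {m = zero}  w f = refl
prod-grid {m = suc m} w f = begin
  prod (List.map w (List.tabulate (f zero) ++ grid (f ∘ suc)))
    ≡⟨ cong prod (List.map-++ w (List.tabulate (f zero)) _) ⟩
  prod (List.map w (List.tabulate (f zero)) ++ List.map w (grid (f ∘ suc)))
    ≡⟨ prod-++ (List.map w (List.tabulate (f zero))) _ ⟩
  prod (List.map w (List.tabulate (f zero))) *ᵐ prod (List.map w (grid (f ∘ suc)))
    ≡⟨ cong₂ _*ᵐ_ (cong prod (List.map-tabulate (f zero) w)) (prod-grid w (f ∘ suc)) ⟩
  prod (List.tabulate λ i → prod (List.tabulate λ j → w (f i j))) ∎
  where open ≡-Reasoning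

-- Injectivity is asked among the members only, because `counts` can identify fillings whose rows
-- are not sorted.
unique-map : ∀ {A B : Set} (f : A → B) {xs} → (∀ {x y} → x ∈ xs → y ∈ xs → f x ≡ f y → x ≡ y) →
             Unique xs → Unique (List.map f xs)
unique-map f inj AllPairs.[]         = AllPairs.[]
unique-map f inj (x∉ AllPairs.∷ xs!) =
  All.map⁺ (All.tabulate λ y∈ eq → All.lookup x∉ y∈ (inj (here refl) (there y∈) eq))
    AllPairs.∷ unique-map f (λ x∈ y∈ → inj (there x∈) (there y∈)) xs!

-- The unknown combine i t stands for S i t; the pinned nodes hold 0 and the parts
-- of the partition.

module System (k′ : ℕ) where

  K N : ℕ
  K = suc k′
  N = K * suc K

  cell : Fin K → Fin (suc K) → Node (suc K) N
  cell i t = inj₂ (combine i t)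

  step : Fin K → Fin K → Edge (suc K) N × Monomial K
  step i t = (cell i (inject₁ t) , cell i (suc t)) , varᵐ t

  -- Strict increase down the columns: the entries of row i + 1 that are at most t must lie under
  -- entries of row i that are below t.
  column : Fin k′ → Fin K → Edge (suc K) N
  column i t = cell (suc i) (suc t) , cell (inject₁ i) (inject₁ t)

  -- Opposite edges pin the last count of a row to its length. For the first count one edge
  -- suffices, as nothing is below 0.
  upper lower start : Fin K → Edge (suc K) N
  upper i = cell i (fromℕ K) , inj₁ (suc i)
  lower i = inj₁ (suc i) , cell i (fromℕ K)
  start i = cell i zero , inj₁ zero

  unweighted : List (Edge (suc K) N)
  unweighted = grid column ++ (List.tabulate upper ++ (List.tabulate lower ++ List.tabulate start))

  system : List (Edge (suc K) N × Monomial K)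
  system = grid step ++ List.map (_, 1ᵐ) unweighted

  length-system : length system ≡ K * K + (k′ * K + (K + (K + K)))
  length-system = begin
    length system
      ≡⟨ List.length-++ (grid step) ⟩
    length (grid step) + length (List.map (_, 1ᵐ {K}) unweighted)
      ≡⟨ cong₂ _+_ (length-grid step) (trans (List.length-map _ unweighted) (List.length-++ (grid column))) ⟩
    K * K + (length (grid column) + length (List.tabulate upper ++ (List.tabulate lower ++ List.tabulate start)))
      ≡⟨ cong (λ x → K * K + x) (cong₂ _+_ (length-grid column)
           (trans (List.length-++ (List.tabulate upper)) (cong₂ _+_ (List.length-tabulate upper)
             (trans (List.length-++ (List.tabulate lower)) (cong₂ _+_ (List.length-tabulate lower) (List.length-tabulate start)))))) ⟩
    K * K + (k′ * K + (K + (K + K))) ∎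
    where open ≡-Reasoning

  entry : Vec ℕ N → Fin K → Fin (suc K) → ℕ
  entry y i t = lookup y (combine i t)

  record Counts (ls : Vec ℕ K) (y : Vec ℕ N) : Set where
    field
      monotone : ∀ i (t : Fin K) → entry y i (inject₁ t) ≤ entry y i (suc t)
      columns  : ∀ (i : Fin k′) (t : Fin K) → entry y (suc i) (suc t) ≤ entry y (inject₁ i) (inject₁ t)
      last     : ∀ i → entry y i (fromℕ K) ≡ lookup ls i
      first    : ∀ i → entry y i zero ≡ 0

  module _ {ls : Vec ℕ K} {y : Vec ℕ N} where

    private
      v = at (0 ∷ ls) y

    Holds : Edge (suc K) N → Set
    Holds (s , t) = v s ≤ v t

    counts⇒sat : Counts ls y → Sat (edgesOf system) (unstrict _) v
    counts⇒sat c = all⇒sat system (All.++⁺ {xs = grid step}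
      (all-grid⁺ step monotone)
      (All.map⁺ {xs = unweighted} (All.++⁺ {P = Holds} {xs = grid column}
        (all-grid⁺ column columns)
        (All.++⁺ {P = Holds} {xs = List.tabulate upper} (All.tabulate⁺ {f = upper} λ i → ≤-reflexive (last i))
          (All.++⁺ {P = Holds} {xs = List.tabulate lower} (All.tabulate⁺ {f = lower} λ i → ≤-reflexive (sym (last i)))
            (All.tabulate⁺ {f = start} λ i → ≤-reflexive (first i)))))))
      where open Counts c

    sat⇒counts : Sat (edgesOf system) (unstrict _) v → Counts ls y
    sat⇒counts σ = record
      { monotone = all-grid⁻ step (All.++⁻ˡ (grid step) all)
      ; columns  = all-grid⁻ {P = Holds} column (All.++⁻ˡ (grid column) rest₁)
      ; last     = λ i → ≤-antisym (All.tabulate⁻ {P = Holds} {f = upper} (All.++⁻ˡ (List.tabulate upper) rest₂) i)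
                                   (All.tabulate⁻ {P = Holds} {f = lower} (All.++⁻ˡ (List.tabulate lower) rest₃) i)
      ; first    = λ i → n≤0⇒n≡0 (All.tabulate⁻ {P = Holds} {f = start} (All.++⁻ʳ (List.tabulate lower) rest₃) i)
      }
      where
      all = sat⇒all system σ
      rest₁ : All Holds unweighted
      rest₁ = All.map⁻ (All.++⁻ʳ (grid step) all)
      rest₂ = All.++⁻ʳ (grid column) rest₁
      rest₃ = All.++⁻ʳ (List.tabulate upper) rest₂

  slackWeight-system : ∀ v → slackWeight (edgesOf system) (unstrict _) (weightsOf system) v ≡
    prod (List.tabulate λ i → prod (List.tabulate λ t → slackOf v (step i t)))
  slackWeight-system v = begin
    slackWeight (edgesOf system) (unstrict _) (weightsOf system) v
      ≡⟨ slackWeight-prod system v ⟩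
    prod (List.map (slackOf v) system)
      ≡⟨ cong prod (List.map-++ (slackOf v) (grid step) _) ⟩
    prod (List.map (slackOf v) (grid step) ++ List.map (slackOf v) (List.map (_, 1ᵐ) unweighted))
      ≡⟨ prod-++ (List.map (slackOf v) (grid step)) _ ⟩
    prod (List.map (slackOf v) (grid step)) *ᵐ prod (List.map (slackOf v) (List.map (_, 1ᵐ) unweighted))
      ≡⟨ cong (prod (List.map (slackOf v) (grid step)) *ᵐ_)
           (prod-ones (All.map⁺ (All.map⁺ (All.universal (λ (s , t) → 1ᵐ^ (v t ∸ v s)) unweighted)))) ⟩
    prod (List.map (slackOf v) (grid step)) *ᵐ 1ᵐ
      ≡⟨ Mono.identityʳ _ ⟩
    prod (List.map (slackOf v) (grid step))
      ≡⟨ prod-grid (slackOf v) step ⟩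
    prod (List.tabulate λ i → prod (List.tabulate λ t → slackOf v (step i t))) ∎
    where open ≡-Reasoning

  count : Tableau K → Fin K × Fin (suc K) → ℕ
  count T (i , t) = below (toℕ t) (row T (toℕ i))

  counts : Tableau K → Vec ℕ N
  counts T = Vec.tabulate (count T ∘ remQuot (suc K))

  lookup-counts : ∀ T i t → entry (counts T) i t ≡ below (toℕ t) (row T (toℕ i))
  lookup-counts T i t = trans (Vec.lookup∘tabulate (count T ∘ remQuot (suc K)) (combine i t)) (cong (count T) (Fin.remQuot-combine i t))

  counts-inject₁ : ∀ T i t → entry (counts T) i (inject₁ t) ≡ below (toℕ t) (row T (toℕ i))
  counts-inject₁ T i t = trans (lookup-counts T i (inject₁ t)) (cong (λ t → below t (row T (toℕ i))) (Fin.toℕ-inject₁ t))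

  cellwise : ∀ {y z : Vec ℕ N} → (∀ i t → entry y i t ≡ entry z i t) → y ≡ z
  cellwise {y} {z} h = Pointwise-≡⇒≡ (ext λ q →
    subst (λ q → lookup y q ≡ lookup z q) (Fin.combine-remQuot {K} (suc K) q) (uncurry h (remQuot {K} (suc K) q)))

  weight-counts : ∀ {T ps} → length T ≡ K →
    weight T ≡ slackWeight (edgesOf system) (unstrict _) (weightsOf system) (at ps (counts T))
  weight-counts {T} {ps} len = begin
    prod (List.map varᵐ (concat T))
      ≡⟨ cong prod (List.concat-map T) ⟨
    prod (concat (List.map (List.map varᵐ) T))
      ≡⟨ prod-concat (List.map (List.map varᵐ) T) ⟩
    prod (List.map prod (List.map (List.map varᵐ) T))
      ≡⟨ cong prod (List.map-∘ T) ⟨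
    prod (List.map (prod ∘ List.map varᵐ) T)
      ≡⟨ cong (prod ∘ List.map (prod ∘ List.map varᵐ)) (tabulate-row T len) ⟨
    prod (List.map (prod ∘ List.map varᵐ) (List.tabulate {n = K} (row T ∘ toℕ)))
      ≡⟨ cong prod (List.map-tabulate {n = K} (row T ∘ toℕ) (prod ∘ List.map varᵐ)) ⟩
    prod (List.tabulate {n = K} λ i → prod (List.map varᵐ (row T (toℕ i))))
      ≡⟨ cong prod (List.tabulate-cong {n = K} λ i → trans (rowWeight (row T (toℕ i)))
           (cong prod (List.tabulate-cong λ t → cong (varᵐ t ^ᵐ_)
             (cong₂ _∸_ (sym (lookup-counts T i (suc t))) (sym (counts-inject₁ T i t)))))) ⟩
    prod (List.tabulate λ i → prod (List.tabulate λ t → slackOf v (step i t)))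
      ≡⟨ slackWeight-system v ⟨
    slackWeight (edgesOf system) (unstrict _) (weightsOf system) v ∎
    where
    open ≡-Reasoning
    v = at ps (counts T)

  module _ (λp : Partition K) where

    private
      ls = parts λp

    tableaux : List (Tableau K)
    tableaux = filter semistandard? (fillings (toList ls))

    parts-step : ∀ (i : Fin k′) → lookup ls (suc i) ≤ lookup ls (inject₁ i)
    parts-step i = VecLinked.lookup⁺ (λ a≥b b≥c → ≤-trans b≥c a≥b) (decreasing λp) (Fin.≤̄⇒inject₁< ≤-refl)

    parts≤first : ∀ i → lookup ls i ≤ firstPart λp
    parts≤first zero    with l ∷ _ ← ls = ≤-refl
    parts≤first (suc i) = go λp i
      where
      go : (λp : Partition K) (i : Fin k′) → lookup (parts λp) (suc i) ≤ firstPart λp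
      go record { parts = l ∷ ls ; decreasing = dec } i =
        VecLinked.lookup⁺ (λ a≥b b≥c → ≤-trans b≥c a≥b) {i = zero} {j = suc i} dec z<s

    row-increasing : ∀ {T : Tableau K} → length T ≡ K → Semistandard T → ∀ i → Increasing (row T (toℕ {K} i))
    row-increasing len (inc , _) i = Linked.Linked⇒AllPairs ≤-trans
      (all-row inc (subst (toℕ i <_) (sym len) (Fin.toℕ<n i)))

    counts-counts : ∀ {T} → T ∈ tableaux → Counts ls (counts T)
    counts-counts {T} T∈ with ∈.∈-filter⁻ semistandard? {xs = fillings (toList ls)} T∈
    ... | T∈f , ss@(_ , col) with ∈-fillings⁻ ls T∈f
    ... | len , lens = record
      { monotone = λ i t → subst₂ _≤_ (sym (counts-inject₁ T i t)) (sym (lookup-counts T i (suc t)))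
                             (below-mono (row T (toℕ i)) (n≤1+n (toℕ t)))
      ; columns  = λ i t → subst₂ _≤_ (sym (lookup-counts T (suc i) (suc t))) (sym (counts-inject₁ T (inject₁ i) t))
                             (column≤ i t)
      ; last     = λ i → trans (lookup-counts T i (fromℕ K))
                           (trans (cong (λ t → below t (row T (toℕ i))) (Fin.toℕ-fromℕ K))
                             (trans (below-all (row T (toℕ i))) (lens i)))
      ; first    = λ i → trans (lookup-counts T i zero) (below-zero (row T (toℕ i)))
      }
      where
      column≤ : ∀ (i : Fin k′) (t : Fin K) →
               below (suc (toℕ t)) (row T (suc (toℕ i))) ≤ below (toℕ t) (row T (toℕ (inject₁ i)))
      column≤ i t = columnStrict⇒below (row T (toℕ (inject₁ i))) (row T (suc (toℕ i)))
        (subst (λ j → ColumnStrict (row T j) (row T (suc (toℕ i)))) (sym (Fin.toℕ-inject₁ i))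
          (linked-row col (subst (suc (toℕ i) <_) (sym len) (s≤s (Fin.toℕ<n i)))))
        (subst₂ _≤_ (sym (lens (suc i))) (sym (lens (inject₁ i))) (parts-step i)) (toℕ t)

    counts-injective : ∀ {T U} → T ∈ tableaux → U ∈ tableaux → counts T ≡ counts U → T ≡ U
    counts-injective {T} {U} T∈ U∈ eq
      with ∈.∈-filter⁻ semistandard? {xs = fillings (toList ls)} T∈ | ∈.∈-filter⁻ semistandard? {xs = fillings (toList ls)} U∈
    ... | T∈f , ssT | U∈f , ssU with ∈-fillings⁻ ls T∈f | ∈-fillings⁻ ls U∈f
    ... | lenT , _ | lenU , _ = begin
      T                                       ≡⟨ tabulate-row T lenT ⟨
      List.tabulate {n = K} (row T ∘ toℕ)     ≡⟨ List.tabulate-cong rows ⟩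
      List.tabulate {n = K} (row U ∘ toℕ)     ≡⟨ tabulate-row U lenU ⟩
      U                                       ∎
      where
      open ≡-Reasoning
      rows : ∀ (i : Fin K) → row T (toℕ i) ≡ row U (toℕ i)
      rows i = increasing-determined (row-increasing lenT ssT i) (row-increasing lenU ssU i) λ t →
        trans (sym (lookup-counts T i (suc t))) (trans (cong (λ y → entry y i (suc t)) eq) (lookup-counts U i (suc t)))

    tableau : Vec ℕ N → Tableau K
    tableau y = List.tabulate λ i → rowOf (entry y i)

    module _ {y : Vec ℕ N} (c : Counts ls y) where
      open Counts c

      private
        f : Fin K → Fin (suc K) → ℕ
        f = entry y

      below-tableau : ∀ i t → below (toℕ t) (rowOf (f i)) ≡ f i t
      below-tableau i t = trans (below-rowOf (f i) (monotone i) t) (cong (f i t ∸_) (first i))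

      counts-tableau : counts (tableau y) ≡ y
      counts-tableau = cellwise λ i t → trans (lookup-counts (tableau y) i t)
        (trans (cong (below (toℕ t)) (row-tabulate (rowOf ∘ f) i)) (below-tableau i t))

      tableau∈ : tableau y ∈ tableaux
      tableau∈ = ∈.∈-filter⁺ semistandard?
        (∈-fillings⁺ ls (rowOf ∘ f) λ i → trans (sym (below-all (rowOf (f i))))
          (trans (cong (λ t → below t (rowOf (f i))) (sym (Fin.toℕ-fromℕ K))) (trans (below-tableau i (fromℕ K)) (last i))))
        ( All.tabulate⁺ (λ i → Linked.AllPairs⇒Linked (rowOf-increasing (f i)))
        , linked-tabulate (rowOf ∘ f) λ i → below⇒columnStrict (rowOf-increasing (f (inject₁ i))) (rowOf-increasing (f (suc i))) λ t →
            subst₂ _≤_ (sym (below-tableau (suc i) (suc t)))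
              (trans (sym (below-tableau (inject₁ i) (inject₁ t))) (cong (λ t → below t (rowOf (f (inject₁ i)))) (Fin.toℕ-inject₁ t)))
              (columns i t) )

    module _ (b : ℕ) (l<2^b : firstPart λp < 2 ^ b) where

      private
        sols = solutions (edgesOf system) (unstrict _) b (0 ∷ ls)
        S? = λ y → sat? (edgesOf system) (unstrict _) (at (0 ∷ ls) y)

      counts∈ : ∀ {T} → T ∈ tableaux → counts T ∈ sols
      counts∈ {T} T∈ = ∈.∈-filter⁺ S? (∈-box b small) (counts⇒sat (counts-counts T∈))
        where
        lens = proj₂ (∈-fillings⁻ ls (proj₁ (∈.∈-filter⁻ semistandard? {xs = fillings (toList ls)} T∈)))
        small : ∀ q → lookup (counts T) q < 2 ^ b
        small q = begin-strict
          lookup (counts T) q        ≡⟨ Vec.lookup∘tabulate (count T ∘ remQuot (suc K)) q ⟩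
          count T (i , t)            ≤⟨ below-≤-length (toℕ t) (row T (toℕ i)) ⟩
          length (row T (toℕ i))     ≡⟨ lens i ⟩
          lookup ls i                ≤⟨ parts≤first i ⟩
          firstPart λp               <⟨ l<2^b ⟩
          2 ^ b                      ∎
          where
          open ≤-Reasoning
          i = proj₁ (remQuot {K} (suc K) q)
          t = proj₂ (remQuot {K} (suc K) q)

      -- Neither list repeats an element, so having the same members is enough for a permutation;
      -- `tableau` supplies the preimages. This is how multiplicities, and hence coefficients, are
      -- preserved.
      tableaux↭solutions : List.map counts tableaux ↭ sols
      tableaux↭solutions = ∼bag⇒↭ (unique∧set⇒bag
        (unique-map counts counts-injective (Unique.filter⁺ semistandard? (fillings-unique (toList ls))))
        (Unique.filter⁺ S? (box-unique N b))
        (mk⇔ to from))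
        where
        to : ∀ {y} → y ∈ List.map counts tableaux → y ∈ sols
        to y∈ with ∈.∈-map⁻ counts y∈
        ... | T , T∈ , refl = counts∈ T∈
        from : ∀ {y} → y ∈ sols → y ∈ List.map counts tableaux
        from {y} y∈ = subst (_∈ List.map counts tableaux) (counts-tableau c) (∈.∈-map⁺ counts (tableau∈ c))
          where
          c : Counts ls y
          c = sat⇒counts (proj₂ (∈.∈-filter⁻ S? {xs = box N b} y∈))

      genPoly↭schur : genPoly (edgesOf system) b (0 ∷ ls) (unstrict _) (weightsOf system) ↭ schur λp
      genPoly↭schur = ↭.↭-sym (begin
        List.map weight tableaux
          ≡⟨ List.map-cong-local (All.tabulate λ {T} T∈ → weight-counts {T} {0 ∷ ls}
               (proj₁ (∈-fillings⁻ ls (proj₁ (∈.∈-filter⁻ semistandard? {xs = fillings (toList ls)} T∈))))) ⟩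
        List.map (wt ∘ counts) tableaux
          ≡⟨ List.map-∘ tableaux ⟩
        List.map wt (List.map counts tableaux)
          ↭⟨ ↭.map⁺ wt tableaux↭solutions ⟩
        List.map wt sols ∎)
        where
        open ↭.PermutationReasoning
        wt = λ y → slackWeight (edgesOf system) (unstrict _) (weightsOf system) (at (0 ∷ ls) y)

    -- The tableau whose i-th row consists of i only is semistandard. A nonzero polynomial is needed
    -- to pass from availability, which admits zero for free, to an actual output source.
    schur-nonempty : ¬ (schur λp ≡ [])
    schur-nonempty eq = ¬Any[] (subst (weight T₀ ∈_) eq (∈.∈-map⁺ weight T₀∈))
      where
      rows₀ : Fin K → List (Fin K)
      rows₀ i = List.replicate (lookup ls i) i
      T₀ = List.tabulate rows₀
      constant : ∀ n (i : Fin K) → Linked Fin._≤_ (List.replicate n i)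
      constant zero          i = []
      constant (suc zero)    i = [-]
      constant (suc (suc n)) i = ≤-refl ∷ constant (suc n) i
      strict : ∀ m n {i j : Fin K} → i Fin.< j → ColumnStrict (List.replicate m i) (List.replicate n j)
      strict zero    n       i<j = []
      strict (suc m) zero    i<j = []
      strict (suc m) (suc n) i<j = i<j ∷ strict m n i<j
      T₀∈ : T₀ ∈ tableaux
      T₀∈ = ∈.∈-filter⁺ semistandard? (∈-fillings⁺ ls rows₀ λ i → List.length-replicate (lookup ls i))
        ( All.tabulate⁺ (λ i → constant (lookup ls i) i)
        , linked-tabulate rows₀ λ i → strict (lookup ls (inject₁ i)) (lookup ls (suc i)) (Fin.≤̄⇒inject₁< ≤-refl) )

-- Gate counts and logarithms

open import Data.Integer.Base using (+_)

binaryLog : ∀ n → ∃[ b ] (2 ^ b ≤ suc n × suc n < 2 ^ suc b)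
binaryLog zero = 0 , ≤-refl , ≤-refl
binaryLog (suc n) with binaryLog n
... | b , lo , hi with suc (suc n) <? 2 ^ suc b
...   | yes lt = b , m≤n⇒m≤1+n lo , lt
...   | no ¬lt = suc b , ≮⇒≥ ¬lt , (begin-strict
        suc (suc n)                ≤⟨ hi ⟩
        2 ^ suc b                  <⟨ ^-monoʳ-< 2 ≤-refl (n<1+n (suc b)) ⟩
        2 ^ suc (suc b)            ∎)
  where open ≤-Reasoning

n<2^n : ∀ n → n < 2 ^ n
n<2^n zero    = ≤-refl
n<2^n (suc n) = begin-strict
  suc n              ≤⟨ n<2^n n ⟩
  2 ^ n              <⟨ ^-monoʳ-< 2 ≤-refl (n<1+n n) ⟩
  2 ^ suc n          ∎
  where open ≤-Reasoning

*-^ : ∀ m n o → (m * n) ^ o ≡ m ^ o * n ^ o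
*-^ m n zero    = refl
*-^ m n (suc o) = trans (cong (m * n *_) (*-^ m n o)) (rearrange m n (m ^ o) (n ^ o))
  where
  rearrange : ∀ a b c d → a * b * (c * d) ≡ a * c * (b * d)
  rearrange = solve-∀

^-cancelˡ-≤ : ∀ o .{{_ : NonZero o}} {m n} → m ^ o ≤ n ^ o → m ≤ n
^-cancelˡ-≤ o h = ≮⇒≥ λ n<m → <⇒≱ (^-monoˡ-< o n<m) h

levelCost≤ : ∀ m n → levelCost m n ≤ 2 ^ (m + n + suc m)
levelCost≤ m n = begin
  m * 1 + 2 ^ m * (2 ^ n * (m + 1 + 1))     ≡⟨ cong (λ x → m * 1 + x) (*-assoc (2 ^ m) (2 ^ n) _) ⟨
  m * 1 + P * (m + 1 + 1)                   ≤⟨ +-monoˡ-≤ _ (*-monoʳ-≤ m P>0) ⟩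
  m * P + P * (m + 1 + 1)                   ≡⟨ collect m P ⟩
  P * (2 * suc m)                           ≤⟨ *-monoʳ-≤ P (*-monoʳ-≤ 2 (n<2^n m)) ⟩
  P * 2 ^ suc m                             ≡⟨ cong (_* 2 ^ suc m) (^-distribˡ-+-* 2 m n) ⟨
  2 ^ (m + n) * 2 ^ suc m                   ≡⟨ ^-distribˡ-+-* 2 (m + n) (suc m) ⟨
  2 ^ (m + n + suc m)                       ∎
  where
  open ≤-Reasoning
  P = 2 ^ m * 2 ^ n
  P>0 : 1 ≤ P
  P>0 = *-mono-≤ (m^n>0 2 m) (m^n>0 2 n)
  collect : ∀ m P → m * P + P * (m + 1 + 1) ≡ P * (2 * suc m)
  collect = solve-∀

-- There are m = 2k² + 2k constraints and n = k² + k unknowns, so `levelCost≤` has exponent 2m + n +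
-- 1 = 5k² + 5k + 1. This is at most 11k², with equality at k = 1.
levelBound : ℕ → ℕ
levelBound k = 2 ^ (11 * (k * k))

avail⇒computable : ∀ {C : Program k} {f g} → Avail C f → f ↭ g → ¬ (g ≡ []) → ComputableWith g (proj₁ C)
avail⇒computable (inj₁ refl)           f↭g g≢[] = contradiction (↭.↭-empty-inv (↭.↭-sym f↭g)) g≢[]
avail⇒computable {C = _ , c} (inj₂ (s , s↭f)) f↭g g≢[] = c , s , ↭.↭-trans s↭f f↭g

module _ (k′ : ℕ) where
  open System k′

  levelCost-system : levelCost (length system) N ≤ levelBound K
  levelCost-system = subst (λ m → levelCost m N ≤ levelBound K) (sym length-system) (begin
    levelCost M N             ≤⟨ levelCost≤ M N ⟩
    2 ^ (M + N + suc M)       ≤⟨ ^-monoʳ-≤ 2 (subst (M + N + suc M ≤_) (arith k′) (m≤m+n _ (6 * k′ * k′ + 7 * k′))) ⟩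
    levelBound K              ∎)
    where
    open ≤-Reasoning
    M = K * K + (k′ * K + (K + (K + K)))
    arith : ∀ k → let K = suc k ; M = K * K + (k * K + (K + (K + K))) in
            M + K * suc K + suc M + (6 * k * k + 7 * k) ≡ 11 * (K * K)
    arith = solve-∀

  private
    empty : Program K
    empty = 0 , []

  weights-avail : AvailMonomials empty (weightsOf system)
  weights-avail = lookup-avail (All.++⁺ (all-grid⁺ step λ i t → inj₂ (var t , ↭.refl))
                                        (All.map⁺ (All.universal (λ _ → 1ᵐ-avail) unweighted)))
    where
    lookup-avail : ∀ {L : List (Edge (suc K) N × Monomial K)} →
                   All (λ (e , w) → Avail empty (w ∷ [])) L → AvailMonomials empty (weightsOf L)
    lookup-avail (a ∷ as) zero    = a
    lookup-avail (a ∷ as) (suc i) = lookup-avail as i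

  schur-computable : ∀ (λp : Partition K) b → firstPart λp < 2 ^ b →
                     ∃[ n ] (ComputableWith (schur λp) n × n ≤ b * levelBound K)
  schur-computable λp b l< = proj₁ result , computable , bound
    where
    pins< : ∀ i → lookup (0 ∷ parts λp) i < 2 ^ b
    pins< zero    = m^n>0 2 b
    pins< (suc i) = ≤-<-trans (parts≤first λp i) l<
    open _⇝[_]_ (genPolysGates (edgesOf system) b (0 ∷ parts λp) (weightsOf system) pins< weights-avail)
    computable : ComputableWith (schur λp) (proj₁ result)
    computable = avail⇒computable (All.lookup gets (∈.∈-map⁺ _ (∈-bitVectors (unstrict _))))
                   (genPoly↭schur λp b l<) (schur-nonempty λp)
    bound : proj₁ result ≤ b * levelBound K
    bound = ≤-trans size (≤-trans (≤-reflexive (ℕ.+-identityʳ _)) (*-monoʳ-≤ b levelCost-system))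

binaryLog⁺ : ∀ l → 1 ≤ l → ∃[ b ] (2 ^ b ≤ l × l < 2 ^ suc b)
binaryLog⁺ (suc l) _ = binaryLog l

schur-complexity : ∀ k → 1 ≤ k → (λp : Partition k) → 2 ≤ firstPart λp →
  ∃[ n ] (ComputableWith (schur λp) n × 2 ^ n ≤ firstPart λp ^ (2 * levelBound k))
schur-complexity k@(suc k′) _ λp 2≤l = size , comp , (begin
  2 ^ size                            ≤⟨ ^-monoʳ-≤ 2 size≤ ⟩
  2 ^ (suc b * levelBound k)          ≡⟨ ^-*-assoc 2 (suc b) (levelBound k) ⟨
  -- Writing λ₁ takes b + 1 bits, where 2 ^ b ≤ λ₁. As 2 ≤ λ₁, the extra bit costs at most another
  -- factor λ₁, whence the 2 in the exponent.
  (2 ^ suc b) ^ levelBound k          ≤⟨ ^-monoˡ-≤ (levelBound k) (*-mono-≤ 2≤l lo) ⟩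
  (l * l) ^ levelBound k              ≡⟨ cong (λ x → (l * x) ^ levelBound k) (*-identityʳ l) ⟨
  (l ^ 2) ^ levelBound k              ≡⟨ ^-*-assoc l 2 (levelBound k) ⟩
  l ^ (2 * levelBound k)              ∎)
  where
  open ≤-Reasoning
  l = firstPart λp
  bracket = binaryLog⁺ l (≤-trans (s≤s z≤n) 2≤l)
  b  = proj₁ bracket
  lo = proj₁ (proj₂ bracket)
  circuit = schur-computable k′ λp (suc b) (proj₂ (proj₂ bracket))
  size = proj₁ circuit
  comp = proj₁ (proj₂ circuit)
  size≤ = proj₂ (proj₂ circuit)

-- The error term and the absolute constant

log₂ : ℕ → ℕ
log₂ zero    = 0
log₂ (suc n) = proj₁ (binaryLog n)

-- This is 11 / log₂ k for k ≥ 2, since mkℚᵘ stores the denominator minus one.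

ε : ℕ → ℚᵘ
ε k = mkℚᵘ (+ 11) (pred (log₂ k))

log₂-mono : ∀ m k → 2 ^ m ≤ k → m ≤ log₂ k
log₂-mono m zero    h = contradiction h (<⇒≱ (m^n>0 2 m))
log₂-mono m (suc n) h with binaryLog n
... | b , lo , hi = s≤s⁻¹ (≰⇒> λ sb≤m → <⇒≱ hi (≤-trans (^-monoʳ-≤ 2 sb≤m) h))

ε→0 : TendsToZero ε
ε→0 (mkℚᵘ p d) (ℚ.*<* 0<δ) = 2 ^ M , λ k Mk → ℚ.*<* (small k (log₂-mono M k Mk) p 0<δ)
  where
  -- A positive δ with denominator d + 1 is at least 1 / (d + 1), so it suffices that log₂ k exceeds
  -- 11 (d + 1).
  M = suc (11 * suc d)
  small : ∀ k → M ≤ log₂ k → ∀ p → + 0 ℤ.* + suc d ℤ.< p ℤ.* + 1 →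
          + 11 ℤ.* + suc d ℤ.< p ℤ.* + suc (pred (log₂ k))
  small k h (+ zero)  (ℤ.+<+ ())
  small k h (+ suc p) _ = ℤ.+<+ (begin-strict
    11 * suc d                          <⟨ h ⟩
    log₂ k                              ≤⟨ suc-pred-≥ (log₂ k) ⟩
    suc (pred (log₂ k))                 ≤⟨ m≤n*m _ (suc p) ⟩
    suc p * suc (pred (log₂ k))         ∎)
    where
    open ≤-Reasoning
    suc-pred-≥ : ∀ n → n ≤ suc (pred n)
    suc-pred-≥ zero    = z≤n
    suc-pred-≥ (suc n) = ≤-refl

-- With L = d + 1 this reads k² (1/4 + 11/L) = k² (L + 44) / (4L), and 3 + 4d is 4L - 1.
-- `PowerAtMost` computes on this form.
exponent : ∀ k d → (+ (k * k) / 1) ℚ.* ((+ 1 / 4) ℚ.+ mkℚᵘ (+ 11) d) ≡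
           mkℚᵘ (+ (k * k * (suc d + 44))) (3 + 4 * d)
exponent k d = cong₂ mkℚᵘ numerator (denominator d)
  where
  numerator : + (k * k) ℤ.* (+ 1 ℤ.* + suc d ℤ.+ + 11 ℤ.* + 4) ≡ + (k * k * (suc d + 44))
  numerator = trans (cong (λ x → + (k * k) ℤ.* (x ℤ.+ + 44)) (ℤ.*-identityˡ (+ suc d))) (sym (ℤ.pos-* (k * k) (suc d + 44)))
  denominator : ∀ d → d + 3 * suc d + 0 ≡ 3 + 4 * d
  denominator = solve-∀

module _ (k u v : ℕ) where

  -- Let L = d + 1. The power 4L clears the denominators: it turns `levelBound k` into (2 ^ L) ^ (44
  -- k²), which is at most k ^ (44 k²). Multiplying by k ^ (k² L) ≥ 1 gives the full exponent.
  bound-large : ∀ d → 2 ^ suc d ≤ k → k ^ (k * k * (suc d + 44)) * v ^ (4 + 4 * d) ≤ u ^ (4 + 4 * d) →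
                levelBound k * v ≤ u
  bound-large d 2^L≤k h = ^-cancelˡ-≤ (4 + 4 * d) (begin
    (levelBound k * v) ^ (4 + 4 * d)                       ≡⟨ *-^ (levelBound k) v (4 + 4 * d) ⟩
    levelBound k ^ (4 + 4 * d) * v ^ (4 + 4 * d)           ≤⟨ *-monoˡ-≤ (v ^ (4 + 4 * d)) power ⟩
    k ^ (k * k * (suc d + 44)) * v ^ (4 + 4 * d)           ≤⟨ h ⟩
    u ^ (4 + 4 * d)                                        ∎)
    where
    open ≤-Reasoning
    rearrange : ∀ s d → 11 * s * (4 + 4 * d) ≡ suc d * (s * 44)
    rearrange = solve-∀
    instance
      k≢0 : NonZero k
      k≢0 = >-nonZero (≤-trans (m^n>0 2 (suc d)) 2^L≤k)
    power : levelBound k ^ (4 + 4 * d) ≤ k ^ (k * k * (suc d + 44))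
    power = begin
      (2 ^ (11 * (k * k))) ^ (4 + 4 * d)   ≡⟨ ^-*-assoc 2 (11 * (k * k)) (4 + 4 * d) ⟩
      2 ^ (11 * (k * k) * (4 + 4 * d))     ≡⟨ cong (2 ^_) (rearrange (k * k) d) ⟩
      2 ^ (suc d * (k * k * 44))           ≡⟨ ^-*-assoc 2 (suc d) (k * k * 44) ⟨
      (2 ^ suc d) ^ (k * k * 44)           ≤⟨ ^-monoˡ-≤ (k * k * 44) 2^L≤k ⟩
      k ^ (k * k * 44)                     ≤⟨ ^-monoʳ-≤ k (*-monoʳ-≤ (k * k) (m≤n+m 44 (suc d))) ⟩
      k ^ (k * k * (suc d + 44))           ∎

-- At k = 1 every power of k is 1, so the constant must carry the entire bound there; for k ≥ 2 a
-- constant 2 would do.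
C₀ : ℕ
C₀ = 2 * levelBound 1

bound-all : ∀ k → 1 ≤ k → ∀ u v → PowerAtMost k ((+ (k * k) / 1) ℚ.* ((+ 1 / 4) ℚ.+ ε k)) u v →
            2 * levelBound k * v ≤ u * C₀
bound-all (suc zero) _ u v h = begin
  -- Here log₂ 1 = 0 and `pred` gives ε 1 = 11, so the exponent is 45/4; with base 1 the hypothesis
  -- reduces to v ^ 4 ≤ u ^ 4.
  C₀ * v  ≤⟨ *-monoʳ-≤ C₀ (^-cancelˡ-≤ 4 {v} {u} (≤-trans (≤-reflexive (sym one)) (subst (λ q → PowerAtMost 1 q u v) (exponent 1 0) h))) ⟩
  C₀ * u  ≡⟨ *-comm C₀ u ⟩
  u * C₀  ∎
  where
  open ≤-Reasoning
  one : 1 ^ 45 * v ^ 4 ≡ v ^ 4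
  one = trans (cong (_* v ^ 4) (^-zeroˡ 45)) (*-identityˡ (v ^ 4))
bound-all k@(suc (suc k′)) _ u v h with binaryLog (suc k′)
... | zero  , _  , hi = contradiction hi λ { (s≤s (s≤s ())) }
... | suc d , lo , hi = begin
  2 * levelBound k * v    ≡⟨ *-assoc 2 (levelBound k) v ⟩
  2 * (levelBound k * v)  ≤⟨ *-monoʳ-≤ 2 (bound-large k u v d lo (subst (λ q → PowerAtMost k q u v) (exponent k d) h)) ⟩
  2 * u                   ≡⟨ *-comm 2 u ⟩
  u * 2                   ≤⟨ *-monoʳ-≤ u (*-monoʳ-≤ 2 (m^n>0 2 11)) ⟩
  u * C₀                  ∎
  where open ≤-Reasoning

corollary1p2 : (∃[ C ] ∃[ ε ]
    (0 < C × TendsToZero ε ×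
    (∀ (k : ℕ) → 1 ≤ k → (p : Partition k) → 2 ≤ firstPart p →
    SemiringComplexityAtMost (schur p)
    (AtMostPowerLog k ((+ (k * k) / 1) ℚ.* ((+ 1 / 4) ℚ.+ ε k)) C (firstPart p)))))
    ×
    (∀ (k : ℕ) → 1 ≤ k →
    ∃[ Cₖ ] (∀ (p : Partition k) → 2 ≤ firstPart p →
    SemiringComplexityAtMost (schur p) (AtMostLog Cₖ 1 (firstPart p))))
corollary1p2 = (C₀ , ε , s≤s z≤n , ε→0 , uniform) , λ k 1≤k → 2 * levelBound k , fixed k 1≤k
  where
  open ≤-Reasoning
  fixed : ∀ k → 1 ≤ k → (p : Partition k) → 2 ≤ firstPart p →
          SemiringComplexityAtMost (schur p) (AtMostLog (2 * levelBound k) 1 (firstPart p))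
  fixed k 1≤k p 2≤l = map₂ (λ {n} → map₂ (subst (λ n → 2 ^ n ≤ firstPart p ^ (2 * levelBound k)) (sym (*-identityʳ n))))
                           (schur-complexity k 1≤k p 2≤l)
  uniform : ∀ k → 1 ≤ k → (p : Partition k) → 2 ≤ firstPart p →
    SemiringComplexityAtMost (schur p) (AtMostPowerLog k ((+ (k * k) / 1) ℚ.* ((+ 1 / 4) ℚ.+ ε k)) C₀ (firstPart p))
  uniform k 1≤k p 2≤l = map₂ (λ {n} → map₂ λ h u v k^q≤u/v → begin
    2 ^ (n * v)                                ≡⟨ ^-*-assoc 2 n v ⟨
    (2 ^ n) ^ v                                ≤⟨ ^-monoˡ-≤ v h ⟩
    (firstPart p ^ (2 * levelBound k)) ^ v     ≡⟨ ^-*-assoc (firstPart p) (2 * levelBound k) v ⟩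
    firstPart p ^ (2 * levelBound k * v)       ≤⟨ ^-monoʳ-≤ (firstPart p) {{>-nonZero (≤-trans (s≤s z≤n) 2≤l)}} (bound-all k 1≤k u v k^q≤u/v) ⟩
    firstPart p ^ (u * C₀)                     ∎) (schur-complexity k 1≤k p 2≤l)
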